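{- Let $(R,\mathfrak{m},\mathbf{k})$ be a complete Noetherian local domain (not necessarily normal) of mixed characteristic $p>0$ with perfect residue field $\mathbf{k}$ of characteristic $p$ and coefficient ring $W(\mathbf{k})$, whose uniformizer is denoted $\pi_{W(\mathbf{k})}$. Let $x_0,\ldots,x_d$ be a set of minimal generators of $\mathfrak{m}$, and assume: (1) if $\pi_{W(\mathbf{k})}\in\mathfrak{m}^2$, we put $\mathbf{x}_{\widetilde a}=\sum_{i=0}^d\widetilde a_ix_i$; (2) if $\pi_{W(\mathbf{k})}\notin\mathfrak{m}^2$, we put $x_0=\pi_{W(\mathbf{k})}$ and $\mathbf{x}_{\widetilde a}=\widetilde a_0\pi_{W(\mathbf{k})}+\sum_{i=1}^d\widetilde a_ix_i$. Suppose that $\mathbf{x}_{\widetilde a}=u\,\mathbf{x}_{\widetilde a'}$ for some $a,a'\in\theta_{W(\mathbf{k})}(\mathbb{P}^d(\mathbf{k}))\subseteq\mathbb{P}^d(W(\mathbf{k}))$ and some $u\in R^\times$. Then $u\in W(\mathbf{k})^\times$.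
   Context: A local domain is of mixed characteristic $p>0$ if its fraction field has characteristic $0$ and its residue field has characteristic $p$. $W(\mathbf{k})$ is the ring of ($p$-typical) Witt vectors, a complete discrete valuation ring with uniformizer $\pi_{W(\mathbf{k})}$, $(\pi_{W(\mathbf{k})})=(p)$; that it is a coefficient ring of $R$ means that an injection $W(\mathbf{k})\hookrightarrow R$ inducing an isomorphism of residue fields is fixed. $\mathbb{P}^d(W(\mathbf{k}))$ is the set of classes of tuples in $W(\mathbf{k})^{d+1}$ with at least one unit coordinate, modulo simultaneous multiplication by units; a lift $\widetilde a=(\widetilde a_0,\ldots,\widetilde a_d)$ of $a$ is a representing tuple (with some unit coordinate). With $[-]:\mathbf{k}\to W(\mathbf{k})$ the Teichmüller map, $\theta_{W(\mathbf{k})}(b_0:\cdots:b_d)=([b_0]:\cdots:[b_d])$. The field $\mathbf{k}$ may be finite. -}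

module Defs where

open import Algebra.Bundles using (CommutativeRing; RawRing)
import Algebra.Definitions
import Algebra.Definitions.RawMagma
import Algebra.Definitions.RawSemiring
open import Algebra.Morphism.Structures using (module RingMorphisms)
import Algebra.Properties.CommutativeSemiring.Binomial
import Algebra.Properties.CommutativeSemiring.Exp
import Algebra.Properties.Monoid.Sum
import Algebra.Properties.Ring
import Algebra.Properties.Semiring.Exp
import Algebra.Properties.Semiring.Mult
import Algebra.Solver.Ring.NaturalCoefficients.Default
open import Data.Empty using (⊥-elim)
open import Data.Fin.Base using (Fin; zero; suc; toℕ; fromℕ; inject₁)
import Data.Fin.Properties as Fin
open import Data.Fin.Subset using (Subset; ⊤; _∈_)
open import Data.Nat.Base as ℕ using (ℕ; zero; suc; _∸_; _<_; _≤_; _!; s≤s; z≤n)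
open import Data.Nat.Combinatorics
  using (_C_; nCn≡1; nCk≡nC[n∸k]; nCk≡n!/k![n-k]!; k![n∸k]!∣n!)
import Data.Nat.Divisibility as ℕ
import Data.Nat.DivMod as ℕ
import Data.Nat.Properties as ℕ
open import Data.Nat.Primality using (Prime; euclidsLemma; ¬prime[0]; ¬prime[1])
open import Data.Product.Base using (Σ; ∃; _×_; _,_; proj₁; proj₂)
open import Data.Sum.Base using (_⊎_; inj₁; inj₂; [_,_]′)
open import Function.Base using (_∘_)
open import Function.Bundles using (_⇔_)
open import Level using (Level; Lift; _⊔_; 0ℓ) renaming (suc to lsuc)
open import Relation.Binary.PropositionalEquality as ≡ using (_≡_)
import Relation.Binary.Reasoning.Setoid
open import Relation.Nullary using (¬_; yes; no)
open import Relation.Unary using (Pred; _⊆_; _≐_; U)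

private
  variable
    c ℓ i j : Level

-- The polynomial ring ℤ[V]: ring terms in the variables V modulo the
-- commutative ring axioms.
infixl 6 _⊞_
infixl 7 _⊠_
infix  8 ⊟_
infix  4 _≋_

data Poly (V : Set) : Set where
  var     : V → Poly V
  𝟎 𝟏     : Poly V
  _⊞_ _⊠_ : Poly V → Poly V → Poly V
  ⊟_      : Poly V → Poly V

data _≋_ {V : Set} : Poly V → Poly V → Set where
  ≋-refl    : ∀ {s} → s ≋ s
  ≋-sym     : ∀ {s t} → s ≋ t → t ≋ s
  ≋-trans   : ∀ {s t u} → s ≋ t → t ≋ u → s ≋ u
  ⊞-cong    : ∀ {s s′ t t′} → s ≋ s′ → t ≋ t′ → s ⊞ t ≋ s′ ⊞ t′
  ⊠-cong    : ∀ {s s′ t t′} → s ≋ s′ → t ≋ t′ → s ⊠ t ≋ s′ ⊠ t′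
  ⊟-cong    : ∀ {s t} → s ≋ t → ⊟ s ≋ ⊟ t
  ⊞-assoc   : ∀ s t u → (s ⊞ t) ⊞ u ≋ s ⊞ (t ⊞ u)
  ⊞-comm    : ∀ s t → s ⊞ t ≋ t ⊞ s
  ⊞-idˡ     : ∀ s → 𝟎 ⊞ s ≋ s
  ⊟-invˡ    : ∀ s → ⊟ s ⊞ s ≋ 𝟎
  ⊠-assoc   : ∀ s t u → (s ⊠ t) ⊠ u ≋ s ⊠ (t ⊠ u)
  ⊠-comm    : ∀ s t → s ⊠ t ≋ t ⊠ s
  ⊠-idˡ     : ∀ s → 𝟏 ⊠ s ≋ s
  ⊠-distrib : ∀ s t u → s ⊠ (t ⊞ u) ≋ s ⊠ t ⊞ s ⊠ u

ℤ[_] : Set → CommutativeRing 0ℓ 0ℓ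
ℤ[ V ] = record
  { Carrier = Poly V ; _≈_ = _≋_ ; _+_ = _⊞_ ; _*_ = _⊠_ ; -_ = ⊟_ ; 0# = 𝟎 ; 1# = 𝟏
  ; isCommutativeRing = record
    { isRing = record
      { +-isAbelianGroup = record
        { isGroup = record
          { isMonoid = record
            { isSemigroup = record
              { isMagma = record
                { isEquivalence = record { refl = ≋-refl ; sym = ≋-sym ; trans = ≋-trans }
                ; ∙-cong = ⊞-cong }
              ; assoc = ⊞-assoc }
            ; identity = ⊞-idˡ , λ s → ≋-trans (⊞-comm s 𝟎) (⊞-idˡ s) }
          ; inverse = ⊟-invˡ , λ s → ≋-trans (⊞-comm s (⊟ s)) (⊟-invˡ s)
          ; ⁻¹-cong = ⊟-cong }
        ; comm = ⊞-comm }
      ; *-cong = ⊠-cong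
      ; *-assoc = ⊠-assoc
      ; *-identity = ⊠-idˡ , λ s → ≋-trans (⊠-comm s 𝟏) (⊠-idˡ s)
      ; distrib = ⊠-distrib , λ s t u → ≋-trans (⊠-comm (t ⊞ u) s)
          (≋-trans (⊠-distrib s t u) (⊞-cong (⊠-comm s t) (⊠-comm s u))) }
    ; *-comm = ⊠-comm } }

module _ (A : RawRing c ℓ) where
  open RawRing A

  eval : {V : Set} → (V → Carrier) → Poly V → Carrier
  eval ρ (var v) = ρ v
  eval ρ 𝟎       = 0#
  eval ρ 𝟏       = 1#
  eval ρ (s ⊞ t) = eval ρ s + eval ρ t
  eval ρ (s ⊠ t) = eval ρ s * eval ρ t
  eval ρ (⊟ s)   = - eval ρ s

module _ (A : CommutativeRing c ℓ) where
  open CommutativeRing A hiding (zero)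

  eval-cong : {V : Set} (ρ : V → Carrier) {s t : Poly V} →
              s ≋ t → eval rawRing ρ s ≈ eval rawRing ρ t
  eval-cong ρ ≋-refl            = refl
  eval-cong ρ (≋-sym e)         = sym (eval-cong ρ e)
  eval-cong ρ (≋-trans e e′)    = trans (eval-cong ρ e) (eval-cong ρ e′)
  eval-cong ρ (⊞-cong e e′)     = +-cong (eval-cong ρ e) (eval-cong ρ e′)
  eval-cong ρ (⊠-cong e e′)     = *-cong (eval-cong ρ e) (eval-cong ρ e′)
  eval-cong ρ (⊟-cong e)        = -‿cong (eval-cong ρ e)
  eval-cong ρ (⊞-assoc s t u)   = +-assoc _ _ _
  eval-cong ρ (⊞-comm s t)      = +-comm _ _
  eval-cong ρ (⊞-idˡ s)         = +-identityˡ _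
  eval-cong ρ (⊟-invˡ s)        = -‿inverseˡ _
  eval-cong ρ (⊠-assoc s t u)   = *-assoc _ _ _
  eval-cong ρ (⊠-comm s t)      = *-comm _ _
  eval-cong ρ (⊠-idˡ s)         = *-identityˡ _
  eval-cong ρ (⊠-distrib s t u) = distribˡ _ _ _

module Ghost (A : RawRing c ℓ) (p : ℕ) where
  open RawRing A
  open Algebra.Definitions.RawSemiring rawSemiring using (_^_) renaming (_×_ to _·_)

  P : Carrier
  P = p · 1#

  Σ< : ℕ → (ℕ → Carrier) → Carrier
  Σ< zero    f = 0#
  Σ< (suc m) f = Σ< m f + f m

  -- The i-th summand of the n-th Witt polynomial at s.
  term : ℕ → (ℕ → Carrier) → ℕ → Carrier
  term n s i = P ^ i * s i ^ (p ℕ.^ (n ∸ i))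

  ghost : ℕ → (ℕ → Carrier) → Carrier
  ghost n s = Σ< (suc n) (term n s)

prime∤! : ∀ {p} → Prime p → ∀ k → k < p → ¬ (p ℕ.∣ k !)
prime∤! {p} pp zero    k<p p∣1 = ¬prime[1] (≡.subst Prime (ℕ.∣1⇒≡1 p∣1) pp)
prime∤! {p} pp (suc k) k<p p∣k! with euclidsLemma (suc k) (k !) pp p∣k!
... | inj₁ p∣1+k = ℕ.<⇒≱ k<p (ℕ.∣⇒≤ p∣1+k)
... | inj₂ p∣k   = prime∤! pp k (ℕ.<-trans (ℕ.n<1+n k) k<p) p∣k

prime∣C : ∀ {p} → Prime p → ∀ k → 0 < k → k < p → p ℕ.∣ p C k
prime∣C {p@(suc _)} pp k@(suc k-1) 0<k k<p
  with euclidsLemma (k ! ℕ.* (p ∸ k) !) (p C k) pp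
         (≡.subst (p ℕ.∣_) (≡.sym factorials) (ℕ.m∣m*n _))
  where
  instance _ = k ℕ.!* (p ∸ k) !≢0
  factorials : k ! ℕ.* (p ∸ k) ! ℕ.* (p C k) ≡ p !
  factorials = ≡.trans (≡.cong (k ! ℕ.* (p ∸ k) ! ℕ.*_) (nCk≡n!/k![n-k]! (ℕ.<⇒≤ k<p)))
    (ℕ.m*[n/m]≡n (k![n∸k]!∣n! (ℕ.<⇒≤ k<p)))
... | inj₂ p∣C = p∣C
... | inj₁ p∣k! with euclidsLemma (k !) ((p ∸ k) !) pp p∣k!
...   | inj₁ d = ⊥-elim (prime∤! pp k k<p d)
...   | inj₂ d = ⊥-elim (prime∤! pp (p ∸ k) (s≤s (ℕ.m∸n≤m _ k-1)) d)
prime∣C {zero} pp _ _ _ = ⊥-elim (¬prime[0] pp)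

module Congruence (A : CommutativeRing c ℓ) where
  open CommutativeRing A hiding (zero)
  open Algebra.Properties.Semiring.Exp semiring
  open Algebra.Properties.CommutativeSemiring.Exp commutativeSemiring using (^-distrib-*)
  open Algebra.Properties.Semiring.Mult semiring using (×-cong; ×-congʳ; ×-homo-1; ×1-homo-*; ×-assoc-*)
    renaming (_×_ to _·_)
  open Algebra.Properties.Ring ring using (-‿+-comm; -‿distribʳ-*)
  open Algebra.Properties.Monoid.Sum +-monoid using (sum; sum-init-last)
  open Algebra.Properties.CommutativeSemiring.Binomial commutativeSemiring
    using (binomialTerm) renaming (theorem to binomial-theorem)
  open Relation.Binary.Reasoning.Setoid setoid
  open Algebra.Solver.Ring.NaturalCoefficients.Default commutativeSemiring

  infix 4 _≡_mod_
  _≡_mod_ : Carrier → Carrier → Carrier → Set (c ⊔ ℓ)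
  x ≡ y mod e = ∃ λ q → x ≈ y + e * q

  private
    variable
      x y z x′ y′ e e′ : Carrier

  mod-reflexive : x ≈ y → x ≡ y mod e
  mod-reflexive {x} {y} {e} x≈y = 0# , (begin
    x          ≈⟨ x≈y ⟩
    y          ≈⟨ +-identityʳ y ⟨
    y + 0#     ≈⟨ +-congˡ (zeroʳ e) ⟨
    y + e * 0# ∎)

  mod-trans : x ≡ y mod e → y ≡ z mod e → x ≡ z mod e
  mod-trans {x} {y} {e} {z} (q , α) (r , β) = r + q , (begin
    x                 ≈⟨ α ⟩
    y + e * q         ≈⟨ +-congʳ β ⟩
    z + e * r + e * q ≈⟨ solve 4 (λ z e r q → z :+ e :* r :+ e :* q := z :+ e :* (r :+ q)) refl z e r q ⟩
    z + e * (r + q)   ∎)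

  mod-sym : x ≡ y mod e → y ≡ x mod e
  mod-sym {x} {y} {e} (q , α) = - q , (begin
    y                      ≈⟨ +-identityʳ y ⟨
    y + 0#                 ≈⟨ +-congˡ (-‿inverseʳ (e * q)) ⟨
    y + (e * q + - (e * q)) ≈⟨ +-assoc _ _ _ ⟨
    y + e * q + - (e * q)  ≈⟨ +-cong (sym α) (-‿distribʳ-* e q) ⟩
    x + e * - q            ∎)

  mod-+ : x ≡ x′ mod e → y ≡ y′ mod e → x + y ≡ x′ + y′ mod e
  mod-+ {x} {x′} {e} {y} {y′} (q , α) (r , β) = q + r , trans (+-cong α β)
    (solve 5 (λ x y e q r → (x :+ e :* q) :+ (y :+ e :* r) := x :+ y :+ e :* (q :+ r)) refl x′ y′ e q r)

  mod-* : x ≡ x′ mod e → y ≡ y′ mod e → x * y ≡ x′ * y′ mod e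
  mod-* {x} {x′} {e} {y} {y′} (q , α) (r , β) = x′ * r + q * y′ + q * (e * r) , trans (*-cong α β)
    (solve 5 (λ x y e q r → (x :+ e :* q) :* (y :+ e :* r)
                          := x :* y :+ e :* (x :* r :+ q :* y :+ q :* (e :* r))) refl x′ y′ e q r)

  mod-neg : x ≡ y mod e → - x ≡ - y mod e
  mod-neg {x} {y} {e} (q , α) = - q , (begin
    - x               ≈⟨ -‿cong α ⟩
    - (y + e * q)     ≈⟨ -‿+-comm y (e * q) ⟨
    - y + - (e * q)   ≈⟨ +-congˡ (-‿distribʳ-* e q) ⟩
    - y + e * - q     ∎)

  mod-scale : ∀ z → x ≡ y mod e → z * x ≡ z * y mod (z * e)
  mod-scale {x} {y} {e} z (q , α) = q , trans (*-congˡ α)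
    (solve 4 (λ z y e q → z :* (y :+ e :* q) := z :* y :+ (z :* e) :* q) refl z y e q)

  mod-modulus : e ≈ e′ → x ≡ y mod e → x ≡ y mod e′
  mod-modulus e≈e′ (q , α) = q , trans α (+-congˡ (*-congʳ e≈e′))

  mod-sum : ∀ {n} (f : Fin n → Carrier) → (∀ i → f i ≡ 0# mod e) → sum f ≡ 0# mod e
  mod-sum {n = zero}  f h = mod-reflexive refl
  mod-sum {n = suc n} f h = mod-trans (mod-+ (h zero) (mod-sum (f ∘ suc) (h ∘ suc)))
    (mod-reflexive (+-identityˡ 0#))

  second-order : ∀ n y e → ∃ λ h →
    (y + e) ^ suc n ≈ y ^ suc n + (suc n · 1#) * (y ^ n * e) + e * e * h
  second-order zero y e = 0# , solve 2 (λ y e →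
    (y :+ e) :* con 1 := y :* con 1 :+ (con 1 :+ con 0) :* (con 1 :* e) :+ e :* e :* con 0) refl y e
  second-order (suc n) y e with second-order n y e
  ... | h , α = (suc n · 1#) * y ^ n + y * h + e * h , trans (*-congˡ α)
    (solve 5 (λ y e Y N h →
         (y :+ e) :* (y :* Y :+ N :* (Y :* e) :+ e :* e :* h)
      := y :* (y :* Y) :+ (con 1 :+ N) :* ((y :* Y) :* e) :+ e :* e :* (N :* Y :+ y :* h :+ e :* h))
      refl y e (y ^ n) (suc n · 1#) h)

  mod-^p : ∀ p k → let P = p · 1# in
           x ≡ y mod P ^ suc k → x ^ p ≡ y ^ p mod P ^ suc (suc k)
  mod-^p zero k h = mod-reflexive refl
  mod-^p {x} {y} p@(suc n) k (q , α) with second-order n y ((p · 1#) ^ suc k * q)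
  ... | h , β = y ^ n * q + (p · 1#) ^ k * q * q * h , trans (^-congˡ p α) (trans β
    (solve 6 (λ Yp A B Y q h →
         Yp :+ A :* (Y :* ((A :* B) :* q)) :+ ((A :* B) :* q) :* ((A :* B) :* q) :* h
      := Yp :+ (A :* (A :* B)) :* (Y :* q :+ B :* q :* q :* h))
      refl (y ^ p) (p · 1#) ((p · 1#) ^ k) (y ^ n) q h))

  mod-^p^ : ∀ p → let P = p · 1# in
            x ≡ y mod P → ∀ k → x ^ (p ℕ.^ k) ≡ y ^ (p ℕ.^ k) mod P ^ suc k
  mod-^p^ {x} {y} p h zero = mod-modulus (sym (*-identityʳ _))
    (mod-trans (mod-reflexive (*-identityʳ x)) (mod-trans h (mod-reflexive (sym (*-identityʳ y)))))
  mod-^p^ {x} {y} p h (suc k) = mod-trans (mod-reflexive (sym (twist x)))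
    (mod-trans (mod-^p p k (mod-^p^ p h k)) (mod-reflexive (twist y)))
    where
    twist : ∀ z → (z ^ (p ℕ.^ k)) ^ p ≈ z ^ (p ℕ.^ suc k)
    twist z = trans (^-assocʳ z (p ℕ.^ k) p) (^-congʳ z (ℕ.*-comm (p ℕ.^ k) p))

  p-multiple : ∀ p m z → p ℕ.∣ m → m · z ≡ 0# mod (p · 1#)
  p-multiple p m z (ℕ.divides q ≡.refl) = (q · 1#) * z , (begin
    (q ℕ.* p) · z                  ≈⟨ ×-congʳ (q ℕ.* p) (*-identityˡ z) ⟨
    (q ℕ.* p) · (1# * z)           ≈⟨ ×-assoc-* (q ℕ.* p) 1# z ⟨
    ((q ℕ.* p) · 1#) * z           ≈⟨ *-congʳ (×1-homo-* q p) ⟩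
    (q · 1#) * (p · 1#) * z        ≈⟨ solve 3 (λ q p z → q :* p :* z := con 0 :+ p :* (q :* z)) refl (q · 1#) (p · 1#) z ⟩
    0# + (p · 1#) * ((q · 1#) * z) ∎)

  freshman : ∀ {p} → Prime p → ∀ x y → (x + y) ^ p ≡ x ^ p + y ^ p mod (p · 1#)
  freshman {zero} pp = ⊥-elim (¬prime[0] pp)
  freshman {p@(suc n)} pp x y =
    mod-trans (mod-reflexive (binomial-theorem p x y))
    (mod-trans (mod-+ (mod-reflexive first) tail)
    (mod-reflexive (+-comm (y ^ p) (x ^ p))))
    where
    t : Fin (suc p) → Carrier
    t = binomialTerm x y p

    once : ∀ {m} → m ≡ 1 → ∀ z → m · z ≈ z
    once ≡.refl z = ×-homo-1 z

    first : t zero ≈ y ^ p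
    first = trans (once (≡.trans (nCk≡nC[n∸k] {0} {p} z≤n) (nCn≡1 p)) _) (*-identityˡ _)

    last : t (suc (fromℕ n)) ≈ x ^ p
    last = begin
      t (suc (fromℕ n))      ≈⟨ once (≡.trans (≡.cong (p C_) top) (nCn≡1 p)) _ ⟩
      x ^ toℕ (fromℕ p) * y ^ (p ∸ toℕ (fromℕ p))
                             ≈⟨ *-cong (^-congʳ x top) (^-congʳ y (≡.trans (≡.cong (p ∸_) top) (ℕ.n∸n≡0 p))) ⟩
      x ^ p * 1#             ≈⟨ *-identityʳ _ ⟩
      x ^ p                  ∎
      where
      top : toℕ (fromℕ p) ≡ p
      top = Fin.toℕ-fromℕ p

    tail : sum (t ∘ suc) ≡ x ^ p mod (p · 1#)
    tail = mod-trans (mod-reflexive (sum-init-last (t ∘ suc)))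
      (mod-trans (mod-+ (mod-sum (t ∘ suc ∘ inject₁) middle) (mod-reflexive last))
      (mod-reflexive (+-identityˡ _)))
      where
      middle : ∀ i → t (suc (inject₁ i)) ≡ 0# mod (p · 1#)
      middle i = p-multiple p _ _ (prime∣C pp _ (s≤s z≤n)
        (s≤s (≡.subst (_< n) (≡.sym (Fin.toℕ-inject₁ i)) (Fin.toℕ<n i))))

-- Existence of the Witt polynomials (Dwork's lemma): φ is an endomorphism
-- lifting the p-th power map modulo p, and a sequence g of ring elements is
-- the ghost sequence of some s as soon as φ (g n) ≡ g (n + 1) mod pⁿ⁺¹.
module Dwork (A : CommutativeRing c ℓ) (p : ℕ) where
  open CommutativeRing A hiding (zero)
  open Algebra.Properties.Semiring.Exp semiring
  open Algebra.Properties.Semiring.Mult semiring using () renaming (_×_ to _·_)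
  open Relation.Binary.Reasoning.Setoid setoid
  open Congruence A
  open Ghost rawRing p

  module FrobeniusLift
    (φ : Carrier → Carrier)
    (φ-hom : RingMorphisms.IsRingHomomorphism rawRing rawRing φ)
    (φ-lift : ∀ x → φ x ≡ x ^ p mod P)
    where

    open RingMorphisms.IsRingHomomorphism φ-hom

    Σ<-mod : ∀ {e} m {f g : ℕ → Carrier} → (∀ i → i < m → f i ≡ g i mod e) → Σ< m f ≡ Σ< m g mod e
    Σ<-mod zero    h = mod-reflexive refl
    Σ<-mod (suc m) h = mod-+ (Σ<-mod m λ i i<m → h i (ℕ.m<n⇒m<1+n i<m)) (h m (ℕ.n<1+n m))

    Σ<-cong : ∀ m {f g : ℕ → Carrier} → (∀ i → i < m → f i ≈ g i) → Σ< m f ≈ Σ< m g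
    Σ<-cong zero    h = refl
    Σ<-cong (suc m) h = +-cong (Σ<-cong m λ i i<m → h i (ℕ.m<n⇒m<1+n i<m)) (h m (ℕ.n<1+n m))

    φ-^ : ∀ x n → φ (x ^ n) ≈ φ x ^ n
    φ-^ x zero    = 1#-homo
    φ-^ x (suc n) = trans (*-homo x (x ^ n)) (*-congˡ (φ-^ x n))

    φ-· : ∀ n → φ (n · 1#) ≈ n · 1#
    φ-· zero    = 0#-homo
    φ-· (suc n) = trans (+-homo 1# (n · 1#)) (+-cong 1#-homo (φ-· n))

    φ-Σ< : ∀ m f → φ (Σ< m f) ≈ Σ< m (φ ∘ f)
    φ-Σ< zero    f = 0#-homo
    φ-Σ< (suc m) f = trans (+-homo _ _) (+-congʳ (φ-Σ< m f))

    φ-term : ∀ n s i → φ (term n s i) ≈ term n (φ ∘ s) i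
    φ-term n s i = trans (*-homo _ _)
      (*-cong (trans (φ-^ P i) (^-congˡ i (φ-· p))) (φ-^ (s i) (p ℕ.^ (n ∸ i))))

    -- term m (s ^ p) i = term (m + 1) s i for i ≤ m
    term-shift : ∀ m s i → i ≤ m → term m (λ j → s j ^ p) i ≈ term (suc m) s i
    term-shift m s i i≤m = *-congˡ (trans (^-assocʳ (s i) p (p ℕ.^ (m ∸ i)))
      (^-congʳ (s i) (≡.cong (p ℕ.^_) (≡.sym (ℕ.+-∸-assoc 1 i≤m)))))

    term-mod : ∀ m (s t : ℕ → Carrier) i → i ≤ m → s i ≡ t i mod P → term m s i ≡ term m t i mod P ^ suc m
    term-mod m s t i i≤m h = mod-modulus
      (trans (sym (^-homo-* P i (suc (m ∸ i))))
        (^-congʳ P (≡.trans (ℕ.+-suc i (m ∸ i)) (≡.cong suc (ℕ.m+[n∸m]≡n i≤m)))))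
      (mod-scale (P ^ i) (mod-^p^ p h (m ∸ i)))

    φ-ghost : ∀ m s → φ (ghost m s) ≡ Σ< (suc m) (term (suc m) s) mod P ^ suc m
    φ-ghost m s = mod-trans
      (mod-reflexive (trans (φ-Σ< (suc m) (term m s)) (Σ<-cong (suc m) λ i _ → φ-term m s i)))
      (mod-trans
        (Σ<-mod (suc m) λ i i<1+m → term-mod m (φ ∘ s) (λ j → s j ^ p) i (ℕ.≤-pred i<1+m) (φ-lift (s i)))
        (mod-reflexive (Σ<-cong (suc m) λ i i<1+m → term-shift m s i (ℕ.≤-pred i<1+m))))

    φ-ghost-mod : ∀ m s → φ (ghost m s) ≡ ghost (suc m) s mod P ^ suc m
    φ-ghost-mod m s = mod-trans (φ-ghost m s) (mod-sym (_ , +-congˡ refl))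

    module _ (g : ℕ → Carrier) (g-mod : ∀ n → φ (g n) ≡ g (suc n) mod P ^ suc n) where

      private
        record Approx (n : ℕ) : Set (c ⊔ ℓ) where
          field
            s  : ℕ → Carrier
            ok : ∀ i → i < n → ghost i s ≈ g i

        open Approx

        next : ∀ n (a : Approx n) → g n ≡ Σ< n (term n (s a)) mod P ^ n
        next zero    a = g 0 , sym (trans (+-identityˡ _) (*-identityˡ _))
        next (suc m) a = mod-trans (mod-sym (g-mod m))
          (mod-trans (mod-reflexive (⟦⟧-cong (sym (ok a m (ℕ.n<1+n m))))) (φ-ghost m (s a)))

        update : ℕ → Carrier → (ℕ → Carrier) → ℕ → Carrier
        update n x f i with i ℕ.≟ n
        ... | yes _ = x
        ... | no  _ = f i

        update-≡ : ∀ n x f → update n x f n ≡ x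
        update-≡ n x f with n ℕ.≟ n
        ... | yes _   = ≡.refl
        ... | no  n≢n = ⊥-elim (n≢n ≡.refl)

        update-< : ∀ n x f i → i < n → update n x f i ≡ f i
        update-< n x f i i<n with i ℕ.≟ n
        ... | yes i≡n = ⊥-elim (ℕ.<⇒≢ i<n i≡n)
        ... | no  _   = ≡.refl

        term-cong : ∀ n (s t : ℕ → Carrier) i → s i ≡ t i → term n s i ≈ term n t i
        term-cong n s t i e = *-congˡ (^-congˡ (p ℕ.^ (n ∸ i)) (reflexive e))

        ghost-cong : ∀ n {s t : ℕ → Carrier} → (∀ i → i ≤ n → s i ≡ t i) → ghost n s ≈ ghost n t
        ghost-cong n {s} {t} h = Σ<-cong (suc n) λ i i<1+n → term-cong n s t i (h i (ℕ.≤-pred i<1+n))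

        step : ∀ n → Approx n → Approx (suc n)
        step n a .s = update n (proj₁ (next n a)) (s a)
        step n a .ok i i<1+n with ℕ.m≤n⇒m<n∨m≡n (ℕ.≤-pred i<1+n)
        ... | inj₁ i<n = trans
          (ghost-cong i λ j j≤i → update-< n (proj₁ (next n a)) (s a) j (ℕ.≤-<-trans j≤i i<n)) (ok a i i<n)
        ... | inj₂ ≡.refl = begin
          Σ< n (term n s′) + P ^ n * s′ n ^ (p ℕ.^ (n ∸ n))
            ≈⟨ +-cong (Σ<-cong n λ j j<n → term-cong n s′ (s a) j (update-< n _ (s a) j j<n))
                      (*-congˡ (trans (^-cong (reflexive (update-≡ n _ (s a))) (≡.cong (p ℕ.^_) (ℕ.n∸n≡0 n)))
                                      (*-identityʳ _))) ⟩
          Σ< n (term n (s a)) + P ^ n * proj₁ (next n a)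
            ≈⟨ proj₂ (next n a) ⟨
          g n ∎
          where s′ = update n (proj₁ (next n a)) (s a)

        approx : ∀ n → Approx n
        approx zero    = record { s = λ _ → 0# ; ok = λ _ () }
        approx (suc n) = step n (approx n)

        limit : ℕ → Carrier
        limit n = s (approx (suc n)) n

        stable : ∀ n i → i < n → s (approx n) i ≡ limit i
        stable (suc n) i i<1+n with ℕ.m≤n⇒m<n∨m≡n (ℕ.≤-pred i<1+n)
        ... | inj₁ i<n    = ≡.trans (update-< n _ _ i i<n) (stable n i i<n)
        ... | inj₂ ≡.refl = ≡.refl

      dwork : Σ (ℕ → Carrier) λ s → ∀ n → ghost n s ≈ g n
      dwork = limit , λ n → trans
        (ghost-cong n λ i i≤n → ≡.sym (stable (suc n) i (s≤s i≤n)))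
        (ok (approx (suc n)) n (ℕ.n<1+n n))

module WittPolynomials {p : ℕ} (pp : Prime p) (V : Set) where
  private
    A = ℤ[ V ]
    open CommutativeRing A hiding (zero)
    open Algebra.Properties.Semiring.Exp semiring
    open Algebra.Properties.CommutativeSemiring.Exp commutativeSemiring using (^-distrib-*)
    open Congruence A
  open Ghost rawRing p public

  φ : Poly V → Poly V
  φ = eval rawRing (λ v → var v ^ p)

  φ-hom : RingMorphisms.IsRingHomomorphism rawRing rawRing φ
  φ-hom = record
    { isSemiringHomomorphism = record
      { isNearSemiringHomomorphism = record
        { +-isMonoidHomomorphism = record
          { isMagmaHomomorphism = record
            { isRelHomomorphism = record { cong = eval-cong A _ }
            ; homo = λ _ _ → refl }
          ; ε-homo = refl }
        ; *-homo = λ _ _ → refl }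
      ; 1#-homo = refl }
    ; -‿homo = λ _ → refl }

  private
    0^p : 0# ^ p ≈ 0#
    0^p = go p pp
      where
      go : ∀ p → Prime p → 0# ^ p ≈ 0#
      go zero    pp = ⊥-elim (¬prime[0] pp)
      go (suc n) pp = zeroˡ _

    1^ : ∀ n → 1# ^ n ≈ 1#
    1^ zero    = refl
    1^ (suc n) = trans (*-identityˡ _) (1^ n)

  φ-lift : ∀ x → φ x ≡ x ^ p mod P
  φ-lift (var v) = mod-reflexive refl
  φ-lift 𝟎       = mod-reflexive (sym 0^p)
  φ-lift 𝟏       = mod-reflexive (sym (1^ p))
  φ-lift (s ⊞ t) = mod-trans (mod-+ (φ-lift s) (φ-lift t)) (mod-sym (freshman pp s t))
  φ-lift (s ⊠ t) = mod-trans (mod-* (φ-lift s) (φ-lift t)) (mod-reflexive (sym (^-distrib-* s t p)))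
  φ-lift (⊟ s)   = mod-trans (mod-neg (φ-lift s)) (mod-sym negated)
    where
    open Relation.Binary.Reasoning.Setoid setoid
    -- (- s)ᵖ + sᵖ ≡ (- s + s)ᵖ ≈ 0
    negated : (- s) ^ p ≡ - (s ^ p) mod P
    negated = mod-trans
      (mod-reflexive (sym (trans (+-assoc _ _ _) (trans (+-congˡ (-‿inverseʳ _)) (+-identityʳ _)))))
      (mod-trans
        (mod-+ (mod-sym (freshman pp (- s) s)) (mod-reflexive refl))
        (mod-reflexive (trans (+-congʳ (trans (^-congˡ p (-‿inverseˡ s)) 0^p)) (+-identityˡ _))))

  open Dwork.FrobeniusLift A p φ φ-hom φ-lift public

module Witt {p : ℕ} (pp : Prime p) where

  module W₁ = WittPolynomials pp ℕ
  module W₂ = WittPolynomials pp (ℕ ⊎ ℕ)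
  module C₁ = Congruence ℤ[ ℕ ]
  module C₂ = Congruence ℤ[ ℕ ⊎ ℕ ]

  X Y : ℕ → Poly (ℕ ⊎ ℕ)
  X = var ∘ inj₁
  Y = var ∘ inj₂

  -- The ghost equations determine these polynomials uniquely, ℤ[V] being
  -- torsion-free.
  abstract
    sums : Σ (ℕ → Poly (ℕ ⊎ ℕ)) λ S → ∀ n → W₂.ghost n S ≋ W₂.ghost n X ⊞ W₂.ghost n Y
    sums = W₂.dwork _ λ n → C₂.mod-+ (W₂.φ-ghost-mod n X) (W₂.φ-ghost-mod n Y)

    products : Σ (ℕ → Poly (ℕ ⊎ ℕ)) λ M → ∀ n → W₂.ghost n M ≋ W₂.ghost n X ⊠ W₂.ghost n Y
    products = W₂.dwork _ λ n → C₂.mod-* (W₂.φ-ghost-mod n X) (W₂.φ-ghost-mod n Y)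

    negatives : Σ (ℕ → Poly ℕ) λ N → ∀ n → W₁.ghost n N ≋ ⊟ W₁.ghost n var
    negatives = W₁.dwork _ λ n → C₁.mod-neg (W₁.φ-ghost-mod n var)

  module _ (k : CommutativeRing c ℓ) where
    open CommutativeRing k hiding (zero)

    teichmüller : Carrier → ℕ → Carrier
    teichmüller a zero    = a
    teichmüller a (suc n) = 0#

    -- Only the raw ring is built; its ring laws follow from those of R as soon
    -- as a monomorphism of raw rings into a commutative ring R is given.
    𝕎 : RawRing c ℓ
    𝕎 = record
      { Carrier = ℕ → Carrier
      ; _≈_     = λ x y → ∀ n → x n ≈ y n
      ; _+_     = λ x y n → eval rawRing [ x , y ]′ (proj₁ sums n)
      ; _*_     = λ x y n → eval rawRing [ x , y ]′ (proj₁ products n)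
      ; -_      = λ x n → eval rawRing x (proj₁ negatives n)
      ; 0#      = λ _ → 0#
      ; 1#      = teichmüller 1#
      }

module _ (A : RawRing c ℓ) where
  open RawRing A
  open Algebra.Definitions.RawSemiring rawSemiring using () renaming (_×_ to _·_)

  IsUnit : Pred Carrier (c ⊔ ℓ)
  IsUnit = Algebra.Definitions.Invertible _≈_ 1# _*_

  HasCharacteristic : ℕ → Set ℓ
  HasCharacteristic n = ∀ m → m · 1# ≈ 0# ⇔ n ℕ.∣ m

  Principal : Carrier → Pred Carrier (c ⊔ ℓ)
  Principal x y = x ∣ y
    where open Algebra.Definitions.RawMagma *-rawMagma

  quotient : Pred Carrier i → RawRing c i
  quotient I = record
    { Carrier = Carrier
    ; _≈_     = λ x y → I (x + - y)
    ; _+_     = _+_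
    ; _*_     = _*_
    ; -_      = -_
    ; 0#      = 0#
    ; 1#      = 1#
    }

  infix 4 _∼_
  _∼_ : ∀ {n} → (x y : Fin n → Carrier) → Set (c ⊔ ℓ)
  x ∼ y = ∃ λ u → IsUnit u × ∀ i → x i ≈ u * y i

  -- Points of ℙᵈ(A) are these representing tuples, identified along _∼_.
  record ℙ (d : ℕ) : Set (c ⊔ ℓ) where
    field
      coord    : Fin (suc d) → Carrier
      has-unit : ∃ λ i → IsUnit (coord i)

module _ (A : CommutativeRing c ℓ) where
  open CommutativeRing A hiding (zero)
  open Algebra.Definitions.RawSemiring (RawRing.rawSemiring rawRing) using (_^_; product; sum)

  record IsDomain : Set (c ⊔ ℓ) where
    field
      nontrivial       : ¬ 1# ≈ 0#
      no-zero-divisors : ∀ x y → x * y ≈ 0# → x ≈ 0# ⊎ y ≈ 0#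

  record Ideal : Set (lsuc (c ⊔ ℓ)) where
    field
      member : Pred Carrier (c ⊔ ℓ)
      resp   : ∀ {x y} → x ≈ y → member x → member y
      0∈     : member 0#
      +∈     : ∀ {x y} → member x → member y → member (x + y)
      *∈     : ∀ r {x} → member x → member (r * x)

  open Ideal

  data ⟨_⟩ (X : Pred Carrier i) : Pred Carrier (c ⊔ ℓ ⊔ i) where
    incl  : ∀ {x} → X x → ⟨ X ⟩ x
    resp′ : ∀ {x y} → x ≈ y → ⟨ X ⟩ x → ⟨ X ⟩ y
    0∈′   : ⟨ X ⟩ 0#
    +∈′   : ∀ {x y} → ⟨ X ⟩ x → ⟨ X ⟩ y → ⟨ X ⟩ (x + y)
    *∈′   : ∀ r {x} → ⟨ X ⟩ x → ⟨ X ⟩ (r * x)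

  Span : ∀ {n} → Subset n → (Fin n → Carrier) → Pred Carrier (c ⊔ ℓ)
  Span S x = ⟨ (λ r → ∃ λ i → i ∈ S × r ≈ x i) ⟩

  Power : Ideal → ℕ → Pred Carrier (c ⊔ ℓ)
  Power I n = ⟨ (λ r → ∃ λ (v : Fin n → Carrier) → (∀ i → member I (v i)) × r ≈ product v) ⟩

  Proper : Ideal → Set (c ⊔ ℓ)
  Proper I = ¬ member I 1#

  IsMaximal : Ideal → Set (lsuc (c ⊔ ℓ))
  IsMaximal M = Proper M × (∀ J → member M ⊆ member J → Proper J → member J ⊆ member M)

  IsLocal : Ideal → Set (lsuc (c ⊔ ℓ))
  IsLocal 𝔪 = IsMaximal 𝔪 × (∀ M → IsMaximal M → member M ≐ member 𝔪)

  IsNoetherian : Set (lsuc (c ⊔ ℓ))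
  IsNoetherian = ∀ I → ∃ λ n → ∃ λ (g : Fin n → Carrier) → member I ≐ Span ⊤ g

  -- A → lim A/𝔪ⁿ is injective and surjective.
  record IsAdicallyComplete (𝔪 : Ideal) : Set (c ⊔ ℓ) where
    field
      separated : ∀ x → (∀ n → Power 𝔪 n x) → x ≈ 0#
      complete  : ∀ (s : ℕ → Carrier) → (∀ n → Power 𝔪 n (s (suc n) - s n)) →
                  ∃ λ l → ∀ n → Power 𝔪 n (l - s n)

  -- Minimality: no proper subfamily generates.
  record MinimallyGenerates {n} (x : Fin n → Carrier) (I : Ideal) : Set (c ⊔ ℓ) where
    field
      generates : member I ≐ Span ⊤ x
      minimal   : ∀ S → member I ≐ Span S x → S ≡ ⊤

  -- For a field of characteristic p.
  IsPerfect : ℕ → Set (c ⊔ ℓ)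
  IsPerfect p = ∀ x → ∃ λ y → y ^ p ≈ x

  FractionField : IsDomain → RawRing (c ⊔ ℓ) ℓ
  FractionField dom = record
    { Carrier = Carrier × ∃ λ b → ¬ b ≈ 0#
    ; _≈_     = λ (a , b , _) (a′ , b′ , _) → a * b′ ≈ a′ * b
    ; _+_     = λ (a , b , b≉0) (a′ , b′ , b′≉0) → a * b′ + a′ * b , b * b′ , *-≉0 b≉0 b′≉0
    ; _*_     = λ (a , b , b≉0) (a′ , b′ , b′≉0) → a * a′ , b * b′ , *-≉0 b≉0 b′≉0
    ; -_      = λ (a , b , b≉0) → - a , b , b≉0
    ; 0#      = 0# , 1# , nontrivial
    ; 1#      = 1# , 1# , nontrivial
    }
    where
    open IsDomain dom
    *-≉0 : ∀ {b b′} → ¬ b ≈ 0# → ¬ b′ ≈ 0# → ¬ b * b′ ≈ 0#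
    *-≉0 b≉0 b′≉0 e = [ b≉0 , b′≉0 ]′ (no-zero-divisors _ _ e)

  infixl 7 _∕_
  _∕_ : Ideal → CommutativeRing c (c ⊔ ℓ)
  _∕_ I = record
    { Carrier = Carrier ; _≈_ = _~_ ; _+_ = _+_ ; _*_ = _*_ ; -_ = -_ ; 0# = 0# ; 1# = 1#
    ; isCommutativeRing = record
      { isRing = record
        { +-isAbelianGroup = record
          { isGroup = record
            { isMonoid = record
              { isSemigroup = record
                { isMagma = record
                  { isEquivalence = record { refl = lift refl ; sym = ~-sym ; trans = ~-trans }
                  ; ∙-cong = ~-+ }
                ; assoc = λ x y z → lift (+-assoc x y z) }
              ; identity = (λ x → lift (+-identityˡ x)) , (λ x → lift (+-identityʳ x)) }
            ; inverse = (λ x → lift (-‿inverseˡ x)) , (λ x → lift (-‿inverseʳ x))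
            ; ⁻¹-cong = ~-neg }
          ; comm = λ x y → lift (+-comm x y) }
        ; *-cong = ~-*
        ; *-assoc = λ x y z → lift (*-assoc x y z)
        ; *-identity = (λ x → lift (*-identityˡ x)) , (λ x → lift (*-identityʳ x))
        ; distrib = (λ x y z → lift (distribˡ x y z)) , (λ x y z → lift (distribʳ x y z)) }
      ; *-comm = λ x y → lift (*-comm x y) } }
    where
    open Relation.Binary.Reasoning.Setoid setoid
    open Algebra.Properties.Ring ring
      using (-‿+-comm; -‿distribʳ-*; -‿distribˡ-*; -‿involutive; -1*x≈-x)
    open Algebra.Solver.Ring.NaturalCoefficients.Default commutativeSemiring
      using (solve; _:=_; _:+_)

    _~_ : Carrier → Carrier → Set (c ⊔ ℓ)
    x ~ y = member I (x - y)

    neg∈ : ∀ {x} → member I x → member I (- x)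
    neg∈ {x} h = resp I (-1*x≈-x x) (*∈ I (- 1#) h)

    lift : ∀ {x y} → x ≈ y → x ~ y
    lift {x} {y} e = resp I (sym (trans (+-congʳ e) (-‿inverseʳ y))) (0∈ I)

    ~-sym : ∀ {x y} → x ~ y → y ~ x
    ~-sym {x} {y} h = resp I (begin
      - (x - y)     ≈⟨ -‿+-comm x (- y) ⟨
      - x + - - y   ≈⟨ +-congˡ (-‿involutive y) ⟩
      - x + y       ≈⟨ +-comm _ _ ⟩
      y - x         ∎) (neg∈ h)

    ~-trans : ∀ {x y z} → x ~ y → y ~ z → x ~ z
    ~-trans {x} {y} {z} h h′ = resp I (begin
      (x - y) + (y - z)     ≈⟨ solve 4 (λ x y′ y z′ → (x :+ y′) :+ (y :+ z′) := x :+ z′ :+ (y′ :+ y)) refl x (- y) y (- z) ⟩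
      (x - z) + (- y + y)   ≈⟨ +-congˡ (-‿inverseˡ y) ⟩
      (x - z) + 0#          ≈⟨ +-identityʳ _ ⟩
      x - z                 ∎) (+∈ I h h′)

    ~-+ : ∀ {x x′ y y′} → x ~ x′ → y ~ y′ → (x + y) ~ (x′ + y′)
    ~-+ {x} {x′} {y} {y′} h h′ = resp I (begin
      (x - x′) + (y - y′)     ≈⟨ solve 4 (λ x a y b → (x :+ a) :+ (y :+ b) := (x :+ y) :+ (a :+ b)) refl x (- x′) y (- y′) ⟩
      (x + y) + (- x′ + - y′) ≈⟨ +-congˡ (-‿+-comm x′ y′) ⟩
      (x + y) - (x′ + y′)     ∎) (+∈ I h h′)

    ~-neg : ∀ {x y} → x ~ y → (- x) ~ (- y)
    ~-neg {x} {y} h = resp I (sym (-‿+-comm x (- y))) (neg∈ h)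

    ~-*ˡ : ∀ r {x y} → x ~ y → (r * x) ~ (r * y)
    ~-*ˡ r {x} {y} h = resp I (trans (distribˡ r x (- y)) (+-congˡ (sym (-‿distribʳ-* r y)))) (*∈ I r h)

    ~-* : ∀ {x x′ y y′} → x ~ x′ → y ~ y′ → (x * y) ~ (x′ * y′)
    ~-* {x} {x′} {y} {y′} h h′ = ~-trans (~-*ˡ x h′)
      (~-trans (lift (*-comm x y′)) (~-trans (~-*ˡ y′ h) (lift (*-comm y′ x′))))

module CoefficientRing {p : ℕ} (pp : Prime p) (R : CommutativeRing c ℓ) (𝔪 : Ideal R) where
  open CommutativeRing R hiding (zero)
  open Algebra.Definitions.RawSemiring (RawRing.rawSemiring rawRing) using (sum)

  𝐤 : CommutativeRing c (c ⊔ ℓ)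
  𝐤 = R ∕ 𝔪

  W : RawRing c (c ⊔ ℓ)
  W = Witt.𝕎 pp 𝐤

  open RawRing W using () renaming (Carrier to ∣W∣; 1# to 1W)

  IsUniformizer : Pred ∣W∣ (c ⊔ ℓ)
  IsUniformizer π = Principal W π ≐ Principal W (p · 1W)
    where open Algebra.Definitions.RawSemiring (RawRing.rawSemiring W) using () renaming (_×_ to _·_)

  record IsCoefficientRing (π : ∣W∣) (ι : ∣W∣ → Carrier) : Set (c ⊔ ℓ) where
    field
      isMonomorphism : RingMorphisms.IsRingMonomorphism W rawRing ι
      -- ι induces W(𝐤)/(π) ≅ R/𝔪; the automorphism of 𝐤 obtained by further
      -- identifying W(𝐤)/(π) with 𝐤 need not be the identity.
      residue-fields : RingMorphisms.IsRingIsomorphism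
                          (quotient W (Principal W π)) (CommutativeRing.rawRing 𝐤) ι

  -- ã is a lift of a point of the image of θ : ℙᵈ(𝐤) → ℙᵈ(W(𝐤)).
  InImageθ : ∀ {d} → ℙ W d → Set (c ⊔ ℓ)
  InImageθ {d} ã = ∃ λ (b : ℙ (CommutativeRing.rawRing 𝐤) d) →
    _∼_ W (ℙ.coord ã) (Witt.teichmüller pp 𝐤 ∘ ℙ.coord b)

  linearForm : ∀ {d} → (∣W∣ → Carrier) → (Fin (suc d) → Carrier) → ℙ W d → Carrier
  linearForm ι x ã = sum λ i → ι (ℙ.coord ã i) * x i

{-# OPTIONS --safe #-}

-- Modulo 𝔪 the minimal generators are linearly independent, so x_ã = u x_ã′
-- forces ã ≡ ū ã′ in 𝐤.  For Teichmüller tuples such a congruence lifts to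
-- ã = w ã′ with w ∈ W(𝐤)ˣ, and then w = u because R is a domain and x_ã′ ≠ 0.
--
-- The multiplicativity of the Teichmüller map used in the lifting step is
-- checked in R instead of 𝐤: R is p-torsion-free, so Witt vectors over R are
-- determined by their ghost components.
module Submission where

open import Defs
open import Algebra.Bundles using (CommutativeRing; RawRing)
import Algebra.Definitions.RawMagma
import Algebra.Definitions.RawSemiring
open import Algebra.Morphism.Structures using (module RingMorphisms)
import Algebra.Properties.CommutativeMonoid.Sum
import Algebra.Properties.CommutativeSemiring.Exp
import Algebra.Properties.Ring
import Algebra.Properties.Semiring.Exp
import Algebra.Properties.Semiring.Sum
import Algebra.Solver.Ring.NaturalCoefficients.Default
open import Data.Empty using (⊥; ⊥-elim)
open import Data.Fin.Base using (Fin; zero; suc; punchIn)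
import Data.Fin.Properties as Fin
open import Data.Fin.Subset using (Subset; ⊤; _∈_) renaming (_-_ to _∖_)
open import Data.Fin.Subset.Properties using (∈⊤; x∈p∧x≢y⇒x∈p-y; x∈p⇒p-x⊂p; ⊂-irref)
open import Data.Nat.Base as ℕ using (ℕ; zero; suc; _∸_; _<_)
import Data.Nat.Divisibility as ℕ
import Data.Nat.Induction as ℕ
import Data.Nat.Properties as ℕ
open import Data.Nat.Primality using (Prime; prime⇒nonZero)
open import Data.Product.Base using (∃; _×_; _,_; proj₁; proj₂)
open import Data.Sum.Base using (_⊎_; inj₁; inj₂; [_,_]′)
open import Function.Base using (_∘_; id)
open import Function.Bundles using (module Equivalence)
open import Level using (Level)
open import Relation.Binary.PropositionalEquality as ≡ using (_≡_)
import Relation.Binary.Reasoning.Setoid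
open import Relation.Nullary using (¬_; yes; no)
open import Relation.Unary using (Pred; _⊆_)

private
  variable
    c ℓ c′ ℓ′ : Level

-- Naturality of polynomial evaluation and of ghost components.

module _ (A : RawRing c ℓ) (B : CommutativeRing c′ ℓ′)
  {f : RawRing.Carrier A → CommutativeRing.Carrier B}
  (f-hom : RingMorphisms.IsRingHomomorphism A (CommutativeRing.rawRing B) f)
  where

  open CommutativeRing B hiding (zero)
  open RingMorphisms.IsRingHomomorphism f-hom

  -- Witt vector operations are evaluations of fixed integer polynomials, so this naturality is what
  -- carries identities between Witt vectors along a ring homomorphism.
  eval-homo : ∀ {V : Set} {ρ : V → RawRing.Carrier A} {ρ′ : V → Carrier} →
              (∀ v → f (ρ v) ≈ ρ′ v) → ∀ s → f (eval A ρ s) ≈ eval rawRing ρ′ s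
  eval-homo h (var v) = h v
  eval-homo h 𝟎       = 0#-homo
  eval-homo h 𝟏       = 1#-homo
  eval-homo h (s ⊞ t) = trans (+-homo _ _) (+-cong (eval-homo h s) (eval-homo h t))
  eval-homo h (s ⊠ t) = trans (*-homo _ _) (*-cong (eval-homo h s) (eval-homo h t))
  eval-homo h (⊟ s)   = trans (-‿homo _) (-‿cong (eval-homo h s))

  private
    module A where
      open RawRing A public
      open Algebra.Definitions.RawSemiring (RawRing.rawSemiring A) public
        using (_^_) renaming (_×_ to _·_)
    open Algebra.Properties.Semiring.Exp semiring using (_^_; ^-congˡ)
    open Algebra.Definitions.RawSemiring (RawRing.rawSemiring rawRing)
      using () renaming (_×_ to _·_)

  ^-homo : ∀ x n → f (x A.^ n) ≈ f x ^ n
  ^-homo x zero    = 1#-homo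
  ^-homo x (suc n) = trans (*-homo _ _) (*-congˡ (^-homo x n))

  ·1-homo : ∀ n → f (n A.· A.1#) ≈ n · 1#
  ·1-homo zero    = 0#-homo
  ·1-homo (suc n) = trans (+-homo _ _) (+-cong 1#-homo (·1-homo n))

  module _ (p : ℕ) where
    private
      module GA = Ghost A p
      module GB = Ghost rawRing p

    -- Applied to an evaluation map out of `ℤ[ V ]`, this turns the ghost equations between
    -- polynomials into identities between ghost components of actual Witt vectors.
    ghost-homo : ∀ n s → f (GA.ghost n s) ≈ GB.ghost n (f ∘ s)
    ghost-homo n s = Σ<-homo (suc n)
      where
      Σ<-homo : ∀ m → f (GA.Σ< m (GA.term n s)) ≈ GB.Σ< m (GB.term n (f ∘ s))
      Σ<-homo zero    = 0#-homo
      Σ<-homo (suc m) = trans (+-homo _ _) (+-cong (Σ<-homo m) (trans (*-homo _ _)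
        (*-cong (trans (^-homo GA.P m) (^-congˡ m (·1-homo p))) (^-homo (s m) (p ℕ.^ (n ∸ m))))))

module _ (A : CommutativeRing c ℓ) where
  open CommutativeRing A hiding (zero)
  open RingMorphisms using (IsRingHomomorphism)

  eval-isRingHomomorphism : ∀ {V : Set} (ρ : V → Carrier) →
    IsRingHomomorphism (CommutativeRing.rawRing ℤ[ V ]) rawRing (eval rawRing ρ)
  eval-isRingHomomorphism ρ = record
    { isSemiringHomomorphism = record
      { isNearSemiringHomomorphism = record
        { +-isMonoidHomomorphism = record
          { isMagmaHomomorphism = record
            { isRelHomomorphism = record { cong = eval-cong A ρ }
            ; homo = λ _ _ → refl }
          ; ε-homo = refl }
        ; *-homo = λ _ _ → refl }
      ; 1#-homo = refl }
    ; -‿homo = λ _ → refl }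

  ∕-reflexive : (I : Ideal A) → ∀ {x y} → x ≈ y → CommutativeRing._≈_ (_∕_ A I) x y
  ∕-reflexive I e = Ideal.resp I (sym (trans (+-congʳ e) (-‿inverseʳ _))) (Ideal.0∈ I)

  ∕-isRingHomomorphism : (I : Ideal A) →
    IsRingHomomorphism rawRing (CommutativeRing.rawRing (_∕_ A I)) id
  ∕-isRingHomomorphism I = record
    { isSemiringHomomorphism = record
      { isNearSemiringHomomorphism = record
        { +-isMonoidHomomorphism = record
          { isMagmaHomomorphism = record
            { isRelHomomorphism = record { cong = ∕-reflexive I }
            ; homo = λ _ _ → Q.refl }
          ; ε-homo = Q.refl }
        ; *-homo = λ _ _ → Q.refl }
      ; 1#-homo = Q.refl }
    ; -‿homo = λ _ → Q.refl }
    where module Q = CommutativeRing (_∕_ A I)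

-- Ghost components over a `p`-torsion-free ring.

module _ (A : CommutativeRing c ℓ) (p : ℕ) where
  open CommutativeRing A hiding (zero)
  open Ghost rawRing p
  open Algebra.Properties.Semiring.Exp semiring
  open Algebra.Properties.Ring ring using (+-cancelˡ; x≈y⇒x∙y⁻¹≈ε; x∙y⁻¹≈ε⇒x≈y; x[y-z]≈xy-xz)
  open Relation.Binary.Reasoning.Setoid setoid

  ghost-zero : ∀ s → ghost 0 s ≈ s 0
  ghost-zero s = trans (+-identityˡ _) (trans (*-identityˡ _) (*-identityʳ _))

  Σ<-cong : ∀ m {f g : ℕ → Carrier} → (∀ {i} → i < m → f i ≈ g i) → Σ< m f ≈ Σ< m g
  Σ<-cong zero    h = refl
  Σ<-cong (suc m) h = +-cong (Σ<-cong m (h ∘ ℕ.m<n⇒m<1+n)) (h (ℕ.n<1+n m))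

  module _ (torsion-free : ∀ x → P * x ≈ 0# → x ≈ 0#) where

    P^-torsion-free : ∀ n x → P ^ n * x ≈ 0# → x ≈ 0#
    P^-torsion-free zero    x h = trans (sym (*-identityˡ x)) h
    P^-torsion-free (suc n) x h =
      P^-torsion-free n x (torsion-free _ (trans (sym (*-assoc _ _ _)) h))

    P^-cancel : ∀ n {x y} → P ^ n * x ≈ P ^ n * y → x ≈ y
    P^-cancel n {x} {y} h = x∙y⁻¹≈ε⇒x≈y x y
      (P^-torsion-free n _ (trans (x[y-z]≈xy-xz _ _ _) (x≈y⇒x∙y⁻¹≈ε h)))

    -- Strong induction: once the lower coordinates agree, the `n`-th ghost components differ only
    -- in the summands `P ^ n * s n` and `P ^ n * t n`, and `P ^ n` can be cancelled.
    ghost-injective : ∀ {s t} → (∀ n → ghost n s ≈ ghost n t) → ∀ n → s n ≈ t n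
    ghost-injective {s} {t} h = ℕ.<-rec (λ n → s n ≈ t n) step
      where
      -- The exponent of the last summand is 1, though `n ∸ n` does not compute for a variable `n`.
      top : ∀ n r → r n ^ (p ℕ.^ (n ∸ n)) ≈ r n
      top n r = trans (^-congʳ (r n) (≡.cong (p ℕ.^_) (ℕ.n∸n≡0 n))) (*-identityʳ _)

      step : ∀ n → (∀ {i} → i < n → s i ≈ t i) → s n ≈ t n
      step n below = begin
        s n                     ≈⟨ top n s ⟨
        s n ^ (p ℕ.^ (n ∸ n))   ≈⟨ P^-cancel n (+-cancelˡ _ _ _ (trans (h n) (+-congʳ (sym lower)))) ⟩
        t n ^ (p ℕ.^ (n ∸ n))   ≈⟨ top n t ⟩
        t n                     ∎
        where
        lower : Σ< n (term n s) ≈ Σ< n (term n t)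
        lower = Σ<-cong n λ {i} i<n → *-congˡ (^-congˡ (p ℕ.^ (n ∸ i)) (below i<n))

-- Teichmüller representatives and zeroth Witt coordinates.

module _ {p : ℕ} (pp : Prime p) (A : CommutativeRing c ℓ) where
  open CommutativeRing A hiding (zero)
  open Witt pp
  open Ghost rawRing p
  open Algebra.Properties.Semiring.Exp semiring using (_^_; ^-congʳ)
  open Algebra.Properties.CommutativeSemiring.Exp commutativeSemiring using (^-distrib-*)
  open Relation.Binary.Reasoning.Setoid setoid
  private module 𝕎 = RawRing (𝕎 A)

  -- The defining ghost equation of the product polynomials, evaluated at the coordinates of `x` and
  -- `y`.
  ghost-product : ∀ n x y → ghost n (x 𝕎.* y) ≈ ghost n x * ghost n y
  ghost-product n x y = begin
    ghost n (x 𝕎.* y)                    ≈⟨ ghost-homo _ A e-hom p n (proj₁ products) ⟨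
    e (W₂.ghost n (proj₁ products))      ≈⟨ eval-cong A _ (proj₂ products n) ⟩
    e (W₂.ghost n X) * e (W₂.ghost n Y)  ≈⟨ *-cong (ghost-homo _ A e-hom p n X) (ghost-homo _ A e-hom p n Y) ⟩
    ghost n x * ghost n y                ∎
    where
    e = eval rawRing [ x , y ]′
    e-hom = eval-isRingHomomorphism A [ x , y ]′

  -- Only the summand of index 0 survives. The others contain a power of `0#` whose exponent
  -- `p ℕ.^ m` has to be nonzero, since `0# ^ 0` is `1#`.
  ghost-teichmüller : ∀ n a → ghost n (teichmüller A a) ≈ a ^ (p ℕ.^ n)
  ghost-teichmüller n a = go n
    where
    0^p^ : ∀ m → 0# ^ (p ℕ.^ m) ≈ 0#
    0^p^ m with p ℕ.^ m in eq
    ... | zero  = ⊥-elim (ℕ.≢-nonZero⁻¹ (p ℕ.^ m) {{ℕ.m^n≢0 p m {{prime⇒nonZero pp}}}} eq)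
    ... | suc _ = zeroˡ _

    -- The number of summands is separated from `n` so that the induction leaves the exponents
    -- alone. Beyond `n` the truncated exponent is 1, which still gives 0.
    go : ∀ m → Σ< (suc m) (term n (teichmüller A a)) ≈ a ^ (p ℕ.^ n)
    go zero    = trans (+-identityˡ _) (*-identityˡ _)
    go (suc m) = trans
      (+-cong (go m) (trans (*-congˡ (0^p^ (n ∸ suc m))) (zeroʳ _))) (+-identityʳ _)

  -- Both sides have the ghost components `(a * b) ^ (p ℕ.^ n)`, and without torsion these determine
  -- the vector.
  teichmüller-*-torsion-free : (∀ x → P * x ≈ 0# → x ≈ 0#) → ∀ a b →
    teichmüller A a 𝕎.* teichmüller A b 𝕎.≈ teichmüller A (a * b)
  teichmüller-*-torsion-free torsion-free a b = ghost-injective A p torsion-free λ n → begin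
    ghost n (teichmüller A a 𝕎.* teichmüller A b)
      ≈⟨ ghost-product n _ _ ⟩
    ghost n (teichmüller A a) * ghost n (teichmüller A b)
      ≈⟨ *-cong (ghost-teichmüller n a) (ghost-teichmüller n b) ⟩
    a ^ (p ℕ.^ n) * b ^ (p ℕ.^ n)
      ≈⟨ ^-distrib-* a b (p ℕ.^ n) ⟨
    (a * b) ^ (p ℕ.^ n)
      ≈⟨ ghost-teichmüller n (a * b) ⟨
    ghost n (teichmüller A (a * b)) ∎

  teichmüller-cong : ∀ {a b} → a ≈ b → teichmüller A a 𝕎.≈ teichmüller A b
  teichmüller-cong a≈b zero    = a≈b
  teichmüller-cong a≈b (suc n) = refl

  -- The zeroth Witt polynomial is the zeroth variable, so the ghost equation of index 0 identifies
  -- the zeroth sum polynomial as `X 0 ⊞ Y 0`. Products and negatives are treated in the same way.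
  +-zeroth : ∀ x y → (x 𝕎.+ y) 0 ≈ x 0 + y 0
  +-zeroth x y = eval-cong A [ x , y ]′ (Z.trans (Z.sym (ghost-zero Z p (proj₁ sums)))
    (Z.trans (proj₂ sums 0) (Z.+-cong (ghost-zero Z p X) (ghost-zero Z p Y))))
    where
    Z = ℤ[ ℕ ⊎ ℕ ]
    module Z = CommutativeRing Z

  *-zeroth : ∀ x y → (x 𝕎.* y) 0 ≈ x 0 * y 0
  *-zeroth x y = eval-cong A [ x , y ]′ (Z.trans (Z.sym (ghost-zero Z p (proj₁ products)))
    (Z.trans (proj₂ products 0) (Z.*-cong (ghost-zero Z p X) (ghost-zero Z p Y))))
    where
    Z = ℤ[ ℕ ⊎ ℕ ]
    module Z = CommutativeRing Z

  -‿zeroth : ∀ x → (𝕎.- x) 0 ≈ - x 0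
  -‿zeroth x = eval-cong A x (Z.trans (Z.sym (ghost-zero Z p (proj₁ negatives)))
    (Z.trans (proj₂ negatives 0) (Z.-‿cong (ghost-zero Z p var))))
    where
    Z = ℤ[ ℕ ]
    module Z = CommutativeRing Z

  open Algebra.Definitions.RawSemiring (RawRing.rawSemiring (𝕎 A))
    using () renaming (_×_ to _·𝕎_)
  open Algebra.Definitions.RawSemiring (RawRing.rawSemiring rawRing)
    using () renaming (_×_ to _·_)

  ·1-zeroth : ∀ n → (n ·𝕎 𝕎.1#) 0 ≈ n · 1#
  ·1-zeroth zero    = refl
  ·1-zeroth (suc n) = trans (+-zeroth _ _) (+-congˡ (·1-zeroth n))

-- Ghost components do not determine Witt vectors over a quotient of characteristic `p`, so the
-- identity is proved over `A` and pushed down. The projection is `id` on carriers, hence `a` and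
-- `b` serve as their own lifts.
teichmüller-*-∕ : ∀ {p} (pp : Prime p) (A : CommutativeRing c ℓ) (I : Ideal A) →
  let open CommutativeRing A hiding (zero)
      open Witt pp
      module 𝕎 = RawRing (𝕎 (_∕_ A I)) in
  (∀ x → Ghost.P rawRing p * x ≈ 0# → x ≈ 0#) → ∀ a b →
  teichmüller (_∕_ A I) a 𝕎.* teichmüller (_∕_ A I) b 𝕎.≈ teichmüller (_∕_ A I) (a * b)
teichmüller-*-∕ pp A I torsion-free a b n = Q.trans
  (Q.sym (eval-homo _ Q (∕-isRingHomomorphism A I) coordinates (proj₁ products n)))
  (Q.trans (∕-reflexive A I (teichmüller-*-torsion-free pp A torsion-free a b n))
  (teichmüller-∕ (a * b) n))
  where
  open CommutativeRing A using (_*_)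
  open Witt pp
  Q = _∕_ A I
  module Q = CommutativeRing Q

  teichmüller-∕ : ∀ a n → teichmüller A a n Q.≈ teichmüller Q a n
  teichmüller-∕ a zero    = Q.refl
  teichmüller-∕ a (suc n) = Q.refl

  coordinates : ∀ v → [ teichmüller A a , teichmüller A b ]′ v
                  Q.≈ [ teichmüller Q a , teichmüller Q b ]′ v
  coordinates (inj₁ n) = teichmüller-∕ a n
  coordinates (inj₂ n) = teichmüller-∕ b n

-- In a domain torsion would force `n · 1# ≈ 0#`. This equation passes to the fraction field, where
-- characteristic 0 makes `n` zero.
char0⇒torsion-free : (A : CommutativeRing c ℓ) (domain : IsDomain A) →
  let open CommutativeRing A hiding (zero) in
  HasCharacteristic (FractionField A domain) 0 →
  ∀ n .{{_ : ℕ.NonZero n}} x → Ghost.P rawRing n * x ≈ 0# → x ≈ 0#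
char0⇒torsion-free A domain char0 n x h with IsDomain.no-zero-divisors domain _ _ h
... | inj₂ x≈0 = x≈0
... | inj₁ n≈0 = ⊥-elim (ℕ.≢-nonZero⁻¹ n (ℕ.0∣⇒≡0 (Equivalence.to (char0 n)
    (trans (*-identityʳ _) (trans (trans (proj₁ (fraction n)) n≈0) (sym (zeroˡ _)))))))
  where
  open CommutativeRing A hiding (zero)
  open Algebra.Definitions.RawSemiring (RawRing.rawSemiring rawRing) using () renaming (_×_ to _·_)
  module F = RawRing (FractionField A domain)
  open Algebra.Definitions.RawSemiring F.rawSemiring using () renaming (_×_ to _·F_)

  -- Adding fractions multiplies denominators, so the denominator of `m ·F F.1#` is a product of
  -- ones and is tracked alongside the numerator.
  fraction : ∀ m → proj₁ (m ·F F.1#) ≈ m · 1# × proj₁ (proj₂ (m ·F F.1#)) ≈ 1#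
  fraction zero    = refl , refl
  fraction (suc m) with fraction m
  ... | num , den = +-cong (trans (*-identityˡ _) den) (trans (*-identityʳ _) num)
                  , trans (*-identityˡ _) den

-- Maximal ideals, inverses in complete rings, and minimal generators.

module _ (A : CommutativeRing c ℓ) (𝔪 : Ideal A) where
  open CommutativeRing A hiding (zero)
  open Ideal 𝔪
  open Algebra.Definitions.RawSemiring (RawRing.rawSemiring rawRing) using (sum; product)
  open Algebra.Properties.Ring ring
    using (-1*x≈-x; x∙y⁻¹≈ε⇒x≈y; +-cancelʳ; //-rightDividesˡ; //-rightDividesʳ;
           -‿distribˡ-*; -‿+-comm; +-inverseʳ-unique)
  open Algebra.Properties.CommutativeMonoid.Sum +-commutativeMonoid using (sum-remove)
  open Algebra.Properties.Semiring.Sum semiring using (*-distribˡ-sum)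
  open Algebra.Solver.Ring.NaturalCoefficients.Default commutativeSemiring
    using (solve; _:=_; _:+_; _:*_)
  open Relation.Binary.Reasoning.Setoid setoid

  -- Maximality is a universal property, so it turns the proper ideal of those
  -- x with ¬ ¬ x ∈ 𝔪 into a subset of 𝔪.
  maximal⇒stable : IsMaximal A 𝔪 → ∀ {x} → ¬ ¬ member x → member x
  maximal⇒stable (proper , maximal) = maximal (record
    { member = λ x → ¬ ¬ member x
    ; resp   = λ e h k → h (k ∘ resp e)
    ; 0∈     = λ k → k 0∈
    ; +∈     = λ h h′ k → h λ x∈ → h′ λ y∈ → k (+∈ x∈ y∈)
    ; *∈     = λ r h k → h (k ∘ *∈ r)
    }) (λ x∈ k → k x∈) (λ h → h proper)

  -- Maximality is applied to the ideal `𝔪 + (r)`. The assumption `k` says exactly that this ideal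
  -- is proper, which is why the conclusion is doubly negated.
  maximal⇒comaximal : IsMaximal A 𝔪 → ∀ {r} → ¬ member r →
                      ¬ ¬ ∃ λ m → ∃ λ s → member m × m + s * r ≈ 1#
  maximal⇒comaximal (_ , maximal) {r} r∉ k = r∉ (maximal 𝔪+r 𝔪⊆ k r∈)
    where
    𝔪+r : Ideal A
    𝔪+r = record
      { member = λ y → ∃ λ m → ∃ λ s → member m × m + s * r ≈ y
      ; resp   = λ y≈z (m , s , m∈ , e) → m , s , m∈ , trans e y≈z
      ; 0∈     = 0# , 0# , 0∈ , trans (+-identityˡ _) (zeroˡ r)
      ; +∈     = λ (m , s , m∈ , e) (m′ , s′ , m′∈ , e′) → m + m′ , s + s′ , +∈ m∈ m′∈ ,
          trans (solve 5 (λ m m′ s s′ r → (m :+ m′) :+ (s :+ s′) :* r := (m :+ s :* r) :+ (m′ :+ s′ :* r))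
                   refl m m′ s s′ r)
                (+-cong e e′)
      ; *∈     = λ t (m , s , m∈ , e) → t * m , t * s , *∈ t m∈ ,
          trans (solve 4 (λ t m s r → t :* m :+ t :* s :* r := t :* (m :+ s :* r)) refl t m s r)
                (*-congˡ e)
      }
    𝔪⊆ : ∀ {x} → member x → Ideal.member 𝔪+r x
    𝔪⊆ {x} x∈ = x , 0# , x∈ , trans (+-congˡ (zeroˡ r)) (+-identityʳ x)
    r∈ : Ideal.member 𝔪+r r
    r∈ = 0# , 1# , 0∈ , trans (+-identityˡ _) (*-identityˡ r)

  -- Here `s` is a partial sum of the geometric series in `m`, `q` the next power and `l` the limit:
  -- the defect of the limit equation is expressed through `l - s` and `q`, which both lie in the
  -- relevant power of the ideal.
  shift : ∀ {m s q l} → s + q ≈ 1# + m * s →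
          l - (1# + m * l) ≈ (l - s) + (- q + - (m * (l - s)))
  shift {m} {s} {q} {l} h = begin
    l - (1# + m * l)             ≈⟨ +-cong (sym (//-rightDividesˡ s l)) (-‿cong expand) ⟩
    (e + s) - ((s + q) + m * e)  ≈⟨ +-congˡ (trans (+-congʳ (-‿+-comm s q)) (-‿+-comm (s + q) (m * e))) ⟨
    (e + s) + ((- s + - q) + f)  ≈⟨ +-assoc e s _ ⟩
    e + (s + ((- s + - q) + f))  ≈⟨ +-congˡ (trans (+-congˡ (+-assoc (- s) (- q) f)) (sym (+-assoc s (- s) _))) ⟩
    e + ((s - s) + (- q + f))    ≈⟨ +-congˡ (trans (+-congʳ (-‿inverseʳ s)) (+-identityˡ _)) ⟩
    e + (- q + f)                ∎
    where
    e = l - s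
    f = - (m * e)
    expand : 1# + m * l ≈ (s + q) + m * e
    expand = begin
      1# + m * l             ≈⟨ +-congˡ (*-congˡ (//-rightDividesˡ s l)) ⟨
      1# + m * (e + s)       ≈⟨ +-congˡ (trans (distribˡ m e s) (+-comm _ _)) ⟩
      1# + (m * s + m * e)   ≈⟨ +-assoc _ _ _ ⟨
      (1# + m * s) + m * e   ≈⟨ +-congʳ h ⟨
      (s + q) + m * e        ∎

  ⟨⟩-minimal : ∀ {i j} {X : Pred Carrier i} {Y : Pred Carrier j} → X ⊆ ⟨_⟩ A Y → ⟨_⟩ A X ⊆ ⟨_⟩ A Y
  ⟨⟩-minimal h (incl x)    = h x
  ⟨⟩-minimal h (resp′ e x) = resp′ e (⟨⟩-minimal h x)
  ⟨⟩-minimal h 0∈′         = 0∈′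
  ⟨⟩-minimal h (+∈′ x y)   = +∈′ (⟨⟩-minimal h x) (⟨⟩-minimal h y)
  ⟨⟩-minimal h (*∈′ r x)   = *∈′ r (⟨⟩-minimal h x)

  sum∈ : ∀ {n k} (S : Subset n) (x : Fin n → Carrier) (g r : Fin k → Carrier) →
         (∀ j → Span A S x (g j)) → Span A S x (sum λ j → r j * g j)
  sum∈ {k = zero}  S x g r h = 0∈′
  sum∈ {k = suc k} S x g r h = +∈′ (*∈′ (r zero) (h zero)) (sum∈ S x (g ∘ suc) (r ∘ suc) (h ∘ suc))

  module _ (adic : IsAdicallyComplete A 𝔪) where
    open IsAdicallyComplete adic

    -- The witness is the sum of all powers of `m`, that is, the inverse of `1# - m`. Completeness
    -- supplies the limit and separatedness the equation.
    geometric-series : ∀ {m} → member m → ∃ λ l → l ≈ 1# + m * l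
    geometric-series {m} m∈ = l , x∙y⁻¹≈ε⇒x≈y _ _ (separated _ remainder)
      where
      power : ℕ → Carrier
      power n = product {n} (λ _ → m)

      power∈ : ∀ n → Power A 𝔪 n (power n)
      power∈ n = incl ((λ _ → m) , (λ _ → m∈) , refl)

      -- The sum stops just before `power n`, so that the `n`-th increment is `power n` itself and
      -- lies in the `n`-th power of the ideal, as `complete` requires.
      partial : ℕ → Carrier
      partial zero    = 0#
      partial (suc n) = partial n + power n

      telescope : ∀ n → partial n + power n ≈ 1# + m * partial n
      telescope zero    = trans (+-comm _ _) (+-congˡ (sym (zeroʳ m)))
      telescope (suc n) = begin
        (partial n + power n) + m * power n      ≈⟨ +-congʳ (telescope n) ⟩
        (1# + m * partial n) + m * power n       ≈⟨ trans (+-assoc _ _ _) (+-congˡ (sym (distribˡ m _ _))) ⟩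
        1# + m * (partial n + power n)           ∎

      step∈ : ∀ n → Power A 𝔪 n (partial (suc n) - partial n)
      step∈ n = resp′ (sym (begin
        (partial n + power n) - partial n   ≈⟨ +-congʳ (+-comm _ _) ⟩
        (power n + partial n) - partial n   ≈⟨ //-rightDividesʳ (partial n) (power n) ⟩
        power n                             ∎)) (power∈ n)

      l : Carrier
      l = proj₁ (complete partial step∈)

      remainder : ∀ n → Power A 𝔪 n (l - (1# + m * l))
      remainder n = resp′ (sym (shift (telescope n)))
        (+∈′ e∈ (+∈′ (neg (power∈ n)) (neg (*∈′ m e∈))))
        where
        e∈ : Power A 𝔪 n (l - partial n)
        e∈ = proj₂ (complete partial step∈) n
        neg : ∀ {x} → Power A 𝔪 n x → Power A 𝔪 n (- x)
        neg {x} h = resp′ (-1*x≈-x x) (*∈′ (- 1#) h)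

    -- Since `s * r` equals `1# - m`, the geometric series `l` inverts it, and `l * s` inverts `r`.
    comaximal⇒invertible : ∀ {m s r} → member m → m + s * r ≈ 1# → ∃ λ t → t * r ≈ 1#
    comaximal⇒invertible {m} {s} {r} m∈ e with geometric-series m∈
    ... | l , l≈ = l * s , +-cancelʳ (m * l) _ _ (begin
      l * s * r + m * l  ≈⟨ solve 4 (λ l s r m → l :* s :* r :+ m :* l := l :* (m :+ s :* r))
                             refl l s r m ⟩
      l * (m + s * r)    ≈⟨ *-congˡ e ⟩
      l * 1#             ≈⟨ *-identityʳ l ⟩
      l                  ≈⟨ l≈ ⟩
      1# + m * l         ∎)

    -- An invertible coefficient of a relation would make its generator redundant.
    relation⇒member : IsMaximal A 𝔪 → ∀ {n} {x : Fin (suc n) → Carrier} → MinimallyGenerates A x 𝔪 →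
                      ∀ (r : Fin (suc n) → Carrier) → sum (λ i → r i * x i) ≈ 0# → ∀ i → member (r i)
    -- Stability of membership makes the goal `⊥`, so the doubly negated comaximality relation may
    -- be opened.
    relation⇒member max {n} {x} gen r relation i = maximal⇒stable max λ r∉ →
      maximal⇒comaximal max r∉ λ (m , s , m∈ , e) →
      let t , tr≈1 = comaximal⇒invertible m∈ e in redundant t tr≈1
      where
      open MinimallyGenerates gen
      S : Subset (suc n)
      S = ⊤ ∖ i

      others : Carrier
      others = sum (λ j → r (punchIn i j) * x (punchIn i j))

      others∈ : Span A S x others
      others∈ = sum∈ S x (x ∘ punchIn i) (r ∘ punchIn i) λ j →
        incl (punchIn i j , x∈p∧x≢y⇒x∈p-y ∈⊤ (Fin.punchInᵢ≢i i j) , refl)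

      module _ (t : Carrier) (tr≈1 : t * r i ≈ 1#) where

        -- The relation multiplied by `t` is solved for `x i`.
        x≈ : (- t) * others ≈ x i
        x≈ = sym (begin
          x i                 ≈⟨ *-identityˡ _ ⟨
          1# * x i            ≈⟨ *-congʳ tr≈1 ⟨
          t * r i * x i       ≈⟨ *-assoc _ _ _ ⟩
          t * (r i * x i)     ≈⟨ +-inverseʳ-unique (t * others) _ cancel ⟩
          - (t * others)      ≈⟨ -‿distribˡ-* t others ⟩
          (- t) * others      ∎)
          where
          cancel : t * others + t * (r i * x i) ≈ 0#
          cancel = begin
            t * others + t * (r i * x i)   ≈⟨ distribˡ _ _ _ ⟨
            t * (others + r i * x i)       ≈⟨ *-congˡ (+-comm _ _) ⟩
            t * (r i * x i + others)       ≈⟨ *-congˡ (sum-remove {i = i} (λ j → r j * x j)) ⟨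
            t * sum (λ j → r j * x j)      ≈⟨ *-congˡ relation ⟩
            t * 0#                         ≈⟨ zeroʳ t ⟩
            0#                             ∎

        generator∈ : ∀ j → Span A S x (x j)
        generator∈ j with j Fin.≟ i
        ... | yes ≡.refl = resp′ x≈ (*∈′ (- t) others∈)
        ... | no  j≢i    = incl (j , x∈p∧x≢y⇒x∈p-y ∈⊤ j≢i , refl)

        ⊤⊆S : Span A ⊤ x ⊆ Span A S x
        ⊤⊆S = ⟨⟩-minimal λ (j , _ , y≈) → resp′ (sym y≈) (generator∈ j)

        S⊆⊤ : Span A S x ⊆ Span A ⊤ x
        S⊆⊤ = ⟨⟩-minimal λ (j , _ , y≈) → incl (j , ∈⊤ , y≈)

        redundant : ⊥
        redundant = ⊂-irref (minimal S (⊤⊆S ∘ proj₁ generates , proj₂ generates ∘ S⊆⊤))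
                      (x∈p⇒p-x⊂p ∈⊤)

-- Residues in the coefficient ring and lifting of proportionality.

module _ {p : ℕ} (pp : Prime p) (R : CommutativeRing c ℓ) (𝔪 : Ideal R) where
  open CommutativeRing R hiding (zero)
  open CoefficientRing pp R 𝔪
  open Witt pp using (teichmüller)
  open Algebra.Solver.Ring.NaturalCoefficients.Default commutativeSemiring
    using (solve; _:=_; _:*_)
  private
    module 𝐤 = CommutativeRing 𝐤
    module W = RawRing W

  -- Brings mutually inverse factors together: `a` with `f`, `b` with `e`, `c` with `d`.
  regroup : ∀ a b c d e f → a * (b * c) * (d * (e * f)) ≈ a * f * (b * e * (d * c))
  regroup = solve 6 (λ a b c d e f → a :* (b :* c) :* (d :* (e :* f)) := a :* f :* (b :* e :* (d :* c))) refl

  -- A multiple of `π` is a multiple of `p`, and the zeroth coordinate of `p` is `p · 1#`, which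
  -- vanishes in `𝐤`.
  uniformizer⇒zeroth≈0 : HasCharacteristic 𝐤.rawRing p → ∀ {π} → IsUniformizer π →
                         ∀ {x} → Principal W π x → x 0 𝐤.≈ 0#
  uniformizer⇒zeroth≈0 char {π} unif {x} π∣x = divisible (proj₁ unif π∣x)
    where
    open Algebra.Definitions.RawSemiring (RawRing.rawSemiring W) using () renaming (_×_ to _·_)
    open Algebra.Definitions.RawMagma W.*-rawMagma using (_∣_; _,_)
    divisible : (p · W.1#) ∣ x → x 0 𝐤.≈ 0#
    divisible (q , e) = 𝐤.trans (𝐤.sym (e 0)) (𝐤.trans (*-zeroth pp 𝐤 q _)
      (𝐤.trans (𝐤.*-congˡ {q 0} (𝐤.trans (·1-zeroth pp 𝐤 p) (Equivalence.from (char p) ℕ.∣-refl)))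
      (𝐤.zeroʳ (q 0))))

  module _ (char : HasCharacteristic 𝐤.rawRing p) {π} (unif : IsUniformizer π)
    {ι : W.Carrier → Carrier} (coeff : IsCoefficientRing π ι) where
    open IsCoefficientRing coeff
    open RingMorphisms.IsRingMonomorphism isMonomorphism
    private
      module ῑ = RingMorphisms.IsRingIsomorphism residue-fields
      module 𝐤ₚ = Algebra.Properties.Ring 𝐤.ring

    -- The class of `ι x` modulo `𝔪` need not be `x 0`, but it determines `x 0`: if the classes
    -- agree, `π` divides the difference, whose zeroth coordinate is then 0.
    zeroth-injective : ∀ {x y} → ι x 𝐤.≈ ι y → x 0 𝐤.≈ y 0
    zeroth-injective {x} {y} e = 𝐤ₚ.x∙y⁻¹≈ε⇒x≈y (x 0) (y 0) (begin
      x 0 - y 0            ≈⟨ 𝐤.+-congˡ {x 0} (-‿zeroth pp 𝐤 y) ⟨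
      x 0 + (W.- y) 0      ≈⟨ +-zeroth pp 𝐤 x (W.- y) ⟨
      (x W.+ (W.- y)) 0    ≈⟨ uniformizer⇒zeroth≈0 char unif (ῑ.injective e) ⟩
      0#                   ∎)
      where open Relation.Binary.Reasoning.Setoid 𝐤.setoid

    residue-lift : ∀ r → ∃ λ v → ι v 𝐤.≈ r
    residue-lift r with ῑ.surjective r
    -- Surjectivity speaks of every representative congruent to `v`, so `π` must be shown to divide
    -- `v - v`. `W` is only a raw ring; the required equation is checked in `R` through the
    -- injectivity of `ι`.
    ... | v , h = v , h (W.0# , injective (trans (*-homo _ _) (trans (*-congʳ 0#-homo)
      (trans (zeroˡ _) (sym (trans (+-homo _ _) (trans (+-congˡ (-‿homo v)) (-‿inverseʳ _))))))))
      where open Algebra.Definitions.RawMagma W.*-rawMagma using (_,_)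

    -- The factor `u` is replaced by the zeroth coordinate of a lift `v`, because `ι` may twist
    -- residues by an automorphism of `𝐤`.
    residue-quotient : ∀ {u x y} v → ι v 𝐤.≈ u → ι x 𝐤.≈ u * ι y → x 0 𝐤.≈ v 0 * y 0
    residue-quotient {u} {x} {y} v v≈u e = 𝐤.trans (zeroth-injective (begin
      ι x           ≈⟨ e ⟩
      u * ι y       ≈⟨ 𝐤.*-congʳ {ι y} v≈u ⟨
      ι v * ι y     ≈⟨ ∕-reflexive R 𝔪 (*-homo v y) ⟨
      ι (v W.* y)   ∎)) (*-zeroth pp 𝐤 v y)
      where open Relation.Binary.Reasoning.Setoid 𝐤.setoid

    inverse-zeroth : ∀ {x y u v} → ι x 𝐤.≈ u → ι y 𝐤.≈ v → u * v ≈ 1# → x 0 * y 0 𝐤.≈ 1#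
    inverse-zeroth {x} {y} {u} {v} x≈u y≈v uv≈1 = 𝐤.trans (𝐤.sym (*-zeroth pp 𝐤 x y))
      (zeroth-injective (begin
        ι (x W.* y)   ≈⟨ ∕-reflexive R 𝔪 (*-homo x y) ⟩
        ι x * ι y     ≈⟨ 𝐤.*-cong x≈u y≈v ⟩
        u * v         ≈⟨ ∕-reflexive R 𝔪 uv≈1 ⟩
        1#            ≈⟨ ∕-reflexive R 𝔪 1#-homo ⟨
        ι W.1#        ∎))
      where open Relation.Binary.Reasoning.Setoid 𝐤.setoid

    ι-* : ∀ x y z → ι (x W.* (y W.* z)) ≈ ι x * (ι y * ι z)
    ι-* x y z = trans (*-homo x (y W.* z)) (*-congˡ (*-homo y z))

    ι-unit : ∀ {x y} → y W.* x W.≈ W.1# → ι y * ι x ≈ 1#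
    ι-unit e = trans (sym (*-homo _ _)) (trans (⟦⟧-cong e) 1#-homo)

    unit⇒member-1 : ∀ {x} → IsUnit W x → Ideal.member 𝔪 (ι x) → Ideal.member 𝔪 1#
    unit⇒member-1 (x⁻¹ , inv , _) x∈ = Ideal.resp 𝔪 (ι-unit inv) (Ideal.*∈ 𝔪 (ι x⁻¹) x∈)

    -- Write `a i` as `λ₁` times the Teichmüller lift of `b i`, and `a′ i` as `λ₂` times that of
    -- `b′ i`. Zeroth coordinates give `b i ≈ γ * b′ i` in `𝐤`; multiplicativity lifts this to an
    -- equality in `W`, so `w` is `λ₁` times the lift of `γ` times the inverse of `λ₂`.
    lift-proportionality :
      (∀ a b → teichmüller 𝐤 a W.* teichmüller 𝐤 b W.≈ teichmüller 𝐤 (a * b)) →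
      ∀ {n} {b b′ : Fin n → Carrier} {a a′ : Fin n → W.Carrier} →
      _∼_ W a (teichmüller 𝐤 ∘ b) → _∼_ W a′ (teichmüller 𝐤 ∘ b′) →
      ∀ {u} → IsUnit rawRing u → (∀ i → ι (a i) 𝐤.≈ u * ι (a′ i)) →
      ∃ λ w → IsUnit W w × ∀ i → ι (a i) ≈ ι w * ι (a′ i)
    lift-proportionality teichmüller-* {b = b} {b′} {a} {a′}
      (λ₁ , (λ₁⁻¹ , λ₁-invˡ , _) , a≈) (λ₂ , (λ₂⁻¹ , λ₂-invˡ , _) , a′≈)
      {u} (u⁻¹ , u-invˡ , _) proportional
      -- The second inverse law follows from the first by commutativity in `R`, pulled back along
      -- `ι`.
      = w , (w⁻¹ , injective w-invˡ , injective (trans (*-homo w w⁻¹) (trans (*-comm _ _)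
               (trans (sym (*-homo w⁻¹ w)) w-invˡ))))
      , ιa≈
      where
      v v⁻¹ : W.Carrier
      v   = proj₁ (residue-lift u)
      v⁻¹ = proj₁ (residue-lift u⁻¹)

      v⁻¹v≈1 : v⁻¹ 0 * v 0 𝐤.≈ 1#
      v⁻¹v≈1 = inverse-zeroth (proj₂ (residue-lift u⁻¹)) (proj₂ (residue-lift u)) u-invˡ

      unit-zeroth : ∀ {x y} → y W.* x W.≈ W.1# → y 0 * x 0 𝐤.≈ 1#
      unit-zeroth {x} {y} e = 𝐤.trans (𝐤.sym (*-zeroth pp 𝐤 y x)) (e 0)

      τ : Carrier → W.Carrier
      τ = teichmüller 𝐤

      -- `𝐤` shares its carrier and operations with `R`, so these products represent elements of
      -- `𝐤`, and ring identities of `R` apply to them through `∕-reflexive`.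
      γ γ⁻¹ : Carrier
      γ   = λ₁⁻¹ 0 * (v 0 * λ₂ 0)
      γ⁻¹ = λ₂⁻¹ 0 * (v⁻¹ 0 * λ₁ 0)

      γ-inv : γ⁻¹ * γ 𝐤.≈ 1#
      γ-inv = begin
        λ₂⁻¹ 0 * (v⁻¹ 0 * λ₁ 0) * (λ₁⁻¹ 0 * (v 0 * λ₂ 0))
          ≈⟨ ∕-reflexive R 𝔪 (regroup (λ₂⁻¹ 0) (v⁻¹ 0) (λ₁ 0) (λ₁⁻¹ 0) (v 0) (λ₂ 0)) ⟩
        λ₂⁻¹ 0 * λ₂ 0 * (v⁻¹ 0 * v 0 * (λ₁⁻¹ 0 * λ₁ 0))
          ≈⟨ 𝐤.*-cong (unit-zeroth λ₂-invˡ) (𝐤.*-cong v⁻¹v≈1 (unit-zeroth λ₁-invˡ)) ⟩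
        1# * (1# * 1#)
          ≈⟨ ∕-reflexive R 𝔪 (trans (*-identityˡ _) (*-identityˡ _)) ⟩
        1# ∎
        where open Relation.Binary.Reasoning.Setoid 𝐤.setoid

      b≈ : ∀ i → b i 𝐤.≈ γ * b′ i
      b≈ i = begin
        b i                             ≈⟨ 𝐤.*-identityˡ (b i) ⟨
        1# * b i                        ≈⟨ 𝐤.*-congʳ {b i} (unit-zeroth λ₁-invˡ) ⟨
        λ₁⁻¹ 0 * λ₁ 0 * b i             ≈⟨ 𝐤.*-assoc (λ₁⁻¹ 0) (λ₁ 0) (b i) ⟩
        λ₁⁻¹ 0 * (λ₁ 0 * b i)           ≈⟨ 𝐤.*-congˡ {λ₁⁻¹ 0} (*-zeroth pp 𝐤 λ₁ (τ (b i))) ⟨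
        λ₁⁻¹ 0 * (λ₁ W.* τ (b i)) 0     ≈⟨ 𝐤.*-congˡ {λ₁⁻¹ 0} (a≈ i 0) ⟨
        λ₁⁻¹ 0 * a i 0                  ≈⟨ 𝐤.*-congˡ {λ₁⁻¹ 0} (residue-quotient v
                                              (proj₂ (residue-lift u)) (proportional i)) ⟩
        λ₁⁻¹ 0 * (v 0 * a′ i 0)         ≈⟨ 𝐤.*-congˡ {λ₁⁻¹ 0} (𝐤.*-congˡ {v 0}
                                              (𝐤.trans (a′≈ i 0) (*-zeroth pp 𝐤 λ₂ (τ (b′ i))))) ⟩
        λ₁⁻¹ 0 * (v 0 * (λ₂ 0 * b′ i))  ≈⟨ ∕-reflexive R 𝔪 (solve 4
                                              (λ l v m b → l :* (v :* (m :* b)) := l :* (v :* m) :* b)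
                                              refl (λ₁⁻¹ 0) (v 0) (λ₂ 0) (b′ i)) ⟩
        γ * b′ i                        ∎
        where open Relation.Binary.Reasoning.Setoid 𝐤.setoid

      τb≈ : ∀ i → τ (b i) W.≈ τ γ W.* τ (b′ i)
      τb≈ i n = 𝐤.trans (teichmüller-cong pp 𝐤 (b≈ i) n) (𝐤.sym (teichmüller-* γ (b′ i) n))

      τγ-inv : τ γ⁻¹ W.* τ γ W.≈ W.1#
      τγ-inv n = 𝐤.trans (teichmüller-* γ⁻¹ γ n) (teichmüller-cong pp 𝐤 γ-inv n)

      w w⁻¹ : W.Carrier
      w   = λ₁ W.* (τ γ W.* λ₂⁻¹)
      w⁻¹ = λ₂ W.* (τ γ⁻¹ W.* λ₁⁻¹)

      w-invˡ : ι (w⁻¹ W.* w) ≈ ι W.1#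
      w-invˡ = begin
        ι (w⁻¹ W.* w)
          ≈⟨ trans (*-homo w⁻¹ w) (*-cong (ι-* λ₂ _ _) (ι-* λ₁ _ _)) ⟩
        ι λ₂ * (ι (τ γ⁻¹) * ι λ₁⁻¹) * (ι λ₁ * (ι (τ γ) * ι λ₂⁻¹))
          ≈⟨ regroup (ι λ₂) (ι (τ γ⁻¹)) (ι λ₁⁻¹) (ι λ₁) (ι (τ γ)) (ι λ₂⁻¹) ⟩
        ι λ₂ * ι λ₂⁻¹ * (ι (τ γ⁻¹) * ι (τ γ) * (ι λ₁ * ι λ₁⁻¹))
          ≈⟨ *-cong (trans (*-comm _ _) (ι-unit λ₂-invˡ))
               (*-cong (ι-unit τγ-inv) (trans (*-comm _ _) (ι-unit λ₁-invˡ))) ⟩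
        1# * (1# * 1#)
          ≈⟨ trans (*-identityˡ _) (*-identityˡ _) ⟩
        1#
          ≈⟨ 1#-homo ⟨
        ι W.1# ∎
        where open Relation.Binary.Reasoning.Setoid setoid

      ιa≈ : ∀ i → ι (a i) ≈ ι w * ι (a′ i)
      ιa≈ i = begin
        ι (a i)
          ≈⟨ trans (⟦⟧-cong (a≈ i)) (*-homo λ₁ (τ (b i))) ⟩
        ι λ₁ * ι (τ (b i))
          ≈⟨ *-congˡ (trans (⟦⟧-cong (τb≈ i)) (*-homo (τ γ) (τ (b′ i)))) ⟩
        ι λ₁ * (ι (τ γ) * ι (τ (b′ i)))
          -- Inserting `ι λ₂⁻¹ * ι λ₂` lets `λ₂` recombine with `τ (b′ i)` into `a′ i`.
          ≈⟨ *-congˡ (*-congˡ (trans (*-congʳ (ι-unit λ₂-invˡ)) (*-identityˡ _))) ⟨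
        ι λ₁ * (ι (τ γ) * (ι λ₂⁻¹ * ι λ₂ * ι (τ (b′ i))))
          ≈⟨ solve 5 (λ l t m n b → l :* (t :* (m :* n :* b)) := l :* (t :* m) :* (n :* b))
               refl (ι λ₁) (ι (τ γ)) (ι λ₂⁻¹) (ι λ₂) (ι (τ (b′ i))) ⟩
        ι λ₁ * (ι (τ γ) * ι λ₂⁻¹) * (ι λ₂ * ι (τ (b′ i)))
          ≈⟨ *-cong (ι-* λ₁ (τ γ) λ₂⁻¹) (trans (⟦⟧-cong (a′≈ i)) (*-homo λ₂ (τ (b′ i)))) ⟨
        ι w * ι (a′ i) ∎
        where open Relation.Binary.Reasoning.Setoid setoid

-- Linear forms that agree up to a unit of `R`.

proposition5p1 : ∀ {c ℓ} (R : CommutativeRing c ℓ) (𝔪 : Ideal R) →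
    let open CommutativeRing R hiding (zero) in
    (domain : IsDomain R) →
    IsNoetherian R →
    IsLocal R 𝔪 →
    IsAdicallyComplete R 𝔪 →
    ∀ {p} (pp : Prime p) →
    let open CoefficientRing pp R 𝔪 in
    HasCharacteristic (FractionField R domain) 0 →
    HasCharacteristic (CommutativeRing.rawRing 𝐤) p →
    IsPerfect 𝐤 p →
    (π : RawRing.Carrier W) (ι : RawRing.Carrier W → Carrier) →
    IsUniformizer π →
    IsCoefficientRing π ι →
    ∀ {d} (x : Fin (suc d) → Carrier) →
    MinimallyGenerates R x 𝔪 →
    (¬ Power R 𝔪 2 (ι π) → x zero ≈ ι π) →
    (ã ã′ : ℙ W d) → InImageθ ã → InImageθ ã′ →
    (u : Carrier) → IsUnit rawRing u →
    linearForm ι x ã ≈ u * linearForm ι x ã′ →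
    ∃ λ w → IsUnit W w × ι w ≈ u
proposition5p1 R 𝔪 domain _ (max , _) adic {p} pp char0 charp _ π ι unif coeff {d} x gen _
  ã ã′ (b , ã∼b) (b′ , ã′∼b′) u u-unit equal = w , w-unit , ιw≈u
  where
  open CommutativeRing R hiding (zero)
  open CoefficientRing pp R 𝔪
  open Algebra.Definitions.RawSemiring (RawRing.rawSemiring rawRing) using (sum)
  open Algebra.Properties.Ring ring using (x∙y⁻¹≈ε⇒x≈y; x≈y⇒x∙y⁻¹≈ε; [y-z]x≈yx-zx; +-cancelʳ; //-rightDividesˡ)
  open Algebra.Properties.CommutativeMonoid.Sum +-commutativeMonoid using (∑-distrib-+; sum-cong-≋)
  open Algebra.Properties.Semiring.Sum semiring using (*-distribˡ-sum)
  open Relation.Binary.Reasoning.Setoid setoid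

  a a′ : Fin (suc d) → Carrier
  a  = ι ∘ ℙ.coord ã
  a′ = ι ∘ ℙ.coord ã′

  independent : ∀ r → sum (λ i → r i * x i) ≈ 0# → ∀ i → Ideal.member 𝔪 (r i)
  independent = relation⇒member R 𝔪 adic max {x = x} gen

  scale : ∀ t → t * linearForm ι x ã′ ≈ sum (λ i → t * a′ i * x i)
  scale t = trans (*-distribˡ-sum t (λ i → a′ i * x i)) (sum-cong-≋ λ i → sym (*-assoc t (a′ i) (x i)))

  -- Adding the second form, scaled by `u`, to both sides avoids negating a sum.
  relation : sum (λ i → (a i - u * a′ i) * x i) ≈ 0#
  relation = +-cancelʳ (u * linearForm ι x ã′) _ _ (begin
    sum (λ i → (a i - u * a′ i) * x i) + u * linearForm ι x ã′
      ≈⟨ +-congˡ (scale u) ⟩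
    sum (λ i → (a i - u * a′ i) * x i) + sum (λ i → u * a′ i * x i)
      ≈⟨ ∑-distrib-+ (λ i → (a i - u * a′ i) * x i) (λ i → u * a′ i * x i) ⟨
    sum (λ i → (a i - u * a′ i) * x i + u * a′ i * x i)
      ≈⟨ sum-cong-≋ (λ i → trans (sym (distribʳ (x i) _ _)) (*-congʳ (//-rightDividesˡ (u * a′ i) (a i)))) ⟩
    linearForm ι x ã
      ≈⟨ equal ⟩
    u * linearForm ι x ã′
      ≈⟨ +-identityˡ _ ⟨
    0# + u * linearForm ι x ã′ ∎)

  torsion-free : ∀ y → Ghost.P rawRing p * y ≈ 0# → y ≈ 0#
  torsion-free = char0⇒torsion-free R domain char0 p {{prime⇒nonZero pp}}

  -- Membership of `a i - u * a′ i` in `𝔪` is by definition the equality of `a i` and `u * a′ i` in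
  -- `𝐤`.
  lifted = lift-proportionality pp R 𝔪 charp unif coeff (teichmüller-*-∕ pp R 𝔪 torsion-free)
             ã∼b ã′∼b′ u-unit (independent (λ i → a i - u * a′ i) relation)
  w      = proj₁ lifted
  w-unit = proj₁ (proj₂ lifted)

  -- A vanishing form would be a relation with coefficients `a′`, putting the image of a unit
  -- coordinate into the proper ideal `𝔪`.
  linearForm≉0 : ¬ linearForm ι x ã′ ≈ 0#
  linearForm≉0 e = let j , unit = ℙ.has-unit ã′ in
    proj₁ max (unit⇒member-1 pp R 𝔪 charp unif coeff unit (independent a′ e j))

  annihilates : (ι w - u) * linearForm ι x ã′ ≈ 0#
  annihilates = trans ([y-z]x≈yx-zx _ _ _) (x≈y⇒x∙y⁻¹≈ε (begin
    ι w * linearForm ι x ã′          ≈⟨ scale (ι w) ⟩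
    sum (λ i → ι w * a′ i * x i)     ≈⟨ sum-cong-≋ (λ i → *-congʳ {x i} (proj₂ (proj₂ lifted) i)) ⟨
    linearForm ι x ã                 ≈⟨ equal ⟩
    u * linearForm ι x ã′            ∎))

  ιw≈u : ι w ≈ u
  ιw≈u = [ x∙y⁻¹≈ε⇒x≈y _ _ , ⊥-elim ∘ linearForm≉0 ]′
           (IsDomain.no-zero-divisors domain _ _ annihilates)
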